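{- Let $(\mathcal N,\mathcal O,\mathfrak l)$, $\mathcal O=\mathcal O(I)$, be an acyclically oriented plabic network which possesses neither internal sources nor internal sinks and represents a point in an irreducible positroid cell. Then all edge vectors $E_e$ (both the internal and the boundary ones) are non-null. Moreover, for every edge $e$, $$E_e=\sum_{j\in\bar I}\Big(\sum_{F\in\mathcal F_{e,b_j}(\mathcal G)}(-1)^{\mathrm{wind}(F)+\mathrm{int}(F)}w(F)\Big)E_j=\sum_{j\in\bar I}\Big((-1)^{\sigma(e,b_j)}\sum_{F\in\mathcal F_{e,b_j}(\mathcal G)}w(F)\Big)E_j,$$ where $E_j$ is the $j$-th vector of the canonical basis of $\mathbb R^n$, $\bar I=[n]\setminus I$, the sum runs over the set $\mathcal F_{e,b_j}(\mathcal G)$ of all directed paths $F$ starting at $e$ and ending at $b_j$, and $\sigma(e,b_j)$ (the parity of $\mathrm{wind}(F)+\mathrm{int}(F)$) is the same for all such $F$. In particular this formula holds for all edges of Le-networks representing points in irreducible positroid cells.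
   Context: $Gr^{\mathrm{TNN}}(k,n)=GL_k^+\backslash Mat^{\mathrm{TNN}}_{k,n}$, where $Mat^{\mathrm{TNN}}_{k,n}$ is the set of real $k\times n$ matrices of rank $k$ with non-negative maximal minors $\Delta_J$. For a matroid $\mathcal M$, the positroid cell is $\mathcal S^{\mathrm{TNN}}_{\mathcal M}=\{[A]:\Delta_J(A)>0\text{ if }J\in\mathcal M,\ \Delta_J(A)=0\text{ if }J\notin\mathcal M\}$; it is irreducible if for every $j\in[n]$ there exist $J,J'\in\mathcal M$ with $j\in J$, $j\notin J'$. Fix positive integers $k<n$. A plabic graph $\mathcal G$ of type $(k,n)$ is a finite directed graph drawn planarly in a disk, with no component isolated from the boundary, such that: it has $n$ boundary vertices $b_1,\dots,b_n$ labelled clockwise, all on a common straight interval of the boundary of the disk, each of degree 1 (a boundary source if its edge is outgoing, a boundary sink if incoming; exactly $k$ are sources); all other (internal) vertices are strictly inside the disk and are bivalent or trivalent; each internal vertex either has exactly one incoming edge (white) or exactly one outgoing edge (black), bivalent vertices being assigned either colour. Edges are straight segments, regarded as vectors directed by the orientation $\mathcal O$. $I=\{i_1<\dots<i_k\}$ indexes the boundary sources. A plabic network $\mathcal N$ is a plabic graph with a positive weight $w_e$ on each edge. The orientation is acyclic if there are no directed cycles. $\mathcal N$ represents $[A]$ if $[A]$ is the class of the matrix with identity submatrix in the columns $I$ and entries $A^r_j=(-1)^{\sigma(i_r,j)}\sum_{P:b_{i_r}\to b_j}(-1)^{\mathrm{wind}_{top}(P)}w(P)$ for $j\in\bar I$,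 where $\sigma(i_r,j)$ is the number of elements of $I$ strictly between $i_r$ and $j$, the sum is over directed walks and $\mathrm{wind}_{top}$ is the topological winding index (it is even for all walks of an acyclic network). A gauge ray direction $\mathfrak l$ is an oriented direction such that the ray in direction $\mathfrak l$ from any boundary vertex points inside the disk, no internal edge is parallel to $\mathfrak l$, and the rays starting at boundary vertices contain no internal vertices. $\mathfrak l_i$ is the ray starting at $b_i$. For plane vectors $s(u,v)=+1,0,-1$ if $(u,v)$ is positively (counterclockwise) oriented, parallel, negatively oriented. For consecutive edges, $\mathrm{wind}(e,f)=\pm1$ if $s(e,f)=s(e,\mathfrak l)=s(\mathfrak l,f)=\pm1$, and $0$ otherwise. $\mathrm{int}(e)$ is the number of intersections of $e$ with the rays $\mathfrak l_{i_r}$, $r\in[k]$ (the common starting point of $\mathfrak l_{i_r}$ and the edge at $b_{i_r}$ is not counted). For a directed path $\mathcal P=(e_1,\dots,e_m)$: $w(\mathcal P)=\prod w_{e_l}$, $\mathrm{wind}(\mathcal P)=\sum_{l=1}^{m-1}\mathrm{wind}(e_l,e_{l+1})$, $\mathrm{int}(\mathcal P)=\sum_{l=1}^m\mathrm{int}(e_l)$. The edge vector $E_e\in\mathbb R^n$ has components $(E_e)_j=\sum_{\mathcal P:e\to b_j}(-1)^{\mathrm{wind}(\mathcal P)+\mathrm{int}(\mathcal P)}w(\mathcal P)$, the sum over all directed paths with first edge $e$ ending at $b_j$ (zero if there is none). Le-networks. A Le-diagram is a filling by $0$'s and $1$'s of a Young diagram contained in a $k\times(n-k)$ rectangle such that a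 box having a $1$ above it in its column and a $1$ to its left in its row contains a $1$. Label the steps of the south-east border path $1,\dots,n$ from the north-east to the south-west corner; boundary vertices are on these steps, those on vertical steps being sources and those on horizontal steps sinks. From each box containing $1$ draw a vertex, a horizontal line to the right up to the border and a vertical line down to the border; orient horizontal edges leftwards and vertical edges downwards. The plabic Le-graph is obtained by replacing each vertex having four edges with a black trivalent vertex (receiving the edges from the right and from above) joined by an edge to a white trivalent vertex (emitting the edges to the left and downwards); other vertices become bivalent, trivalent white (in: right; out: left, down) or trivalent black (in: right, above; out: down). A Le-network is such a graph with positive edge weights and this canonical (acyclic) orientation. -}

module Defs where

open import Algebra.Bundles using (CommutativeRing)
open import Algebra.Core using (Op₁; Op₂)
open import Algebra.Structures using (IsCommutativeRing)
import Algebra.Properties.Ring as RingProperties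
import Algebra.Properties.Semiring.Mult as SemiringMult
import Algebra.Solver.Ring
open import Algebra.Solver.Ring.AlmostCommutativeRing
  using (AlmostCommutativeRing; fromCommutativeRing; _-Raw-AlmostCommutative⟶_)
open import Data.Bool using (Bool; true; false; if_then_else_)
open import Data.Fin as Fin using (Fin; zero; suc; toℕ; punchIn)
import Data.Fin.Properties as Fin
open import Data.Fin.Subset as Subset using (Subset; inside; outside; _∈_; _∉_; ∣_∣; ⁅_⁆; _∪_)
open import Data.Fin.Subset.Properties using (_∈?_)
open import Data.Integer as ℤ using (ℤ; +_; -[1+_])
import Data.Integer.Properties as ℤ
open import Data.List as List
  using (List; []; _∷_; _++_; length; filter; map; concatMap; foldr; allFin)
import Data.List.Membership.Propositional as Membership
open import Data.List.Membership.Propositional.Properties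
  using (∈-++⁺ˡ; ∈-++⁺ʳ; ∈-++⁻; ∈-map⁺; ∈-map⁻; ∈-concatMap⁺; ∈-concatMap⁻;
         ∈-filter⁺; ∈-filter⁻; ∈-allFin)
open import Data.List.Relation.Binary.Disjoint.Propositional using (Disjoint)
open import Data.List.Relation.Unary.All as All using (All; []; _∷_)
import Data.List.Relation.Unary.All.Properties as All
open import Data.List.Relation.Unary.AllPairs as AllPairs using ([]; _∷_)
import Data.List.Relation.Unary.AllPairs.Properties as AllPairs
open import Data.List.Relation.Unary.Any as Any using (here; there)
open import Data.List.Relation.Unary.Unique.Propositional using (Unique)
import Data.List.Relation.Unary.Unique.Propositional.Properties as Unique
open import Data.Maybe using (Maybe; just; nothing)
open import Data.Nat as ℕ using (ℕ; zero; suc; parity; _∸_; z≤n; s≤s)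
import Data.Nat.Properties as ℕ
open import Data.Parity using (Parity; 0ℙ; 1ℙ)
open import Data.Product using (Σ-syntax; ∃; ∃-syntax; _×_; _,_; proj₁; proj₂)
open import Data.Sum using (_⊎_; inj₁; inj₂)
open import Data.Sum.Properties using () renaming (≡-dec to ⊎-≡-dec)
open import Data.Vec as Vec using (Vec; []; _∷_)
open import Function using (_∘_)
open import Function.Bundles using (_↔_; _⇔_; Inverse)
open import Level using (0ℓ)
open import Relation.Binary.Construct.Closure.Equivalence using (EqClosure)
open import Relation.Binary.Construct.Closure.Transitive using (TransClosure; [_]; _∷_)
open import Relation.Binary.Core using (Rel)
open import Relation.Binary.Definitions using (DecidableEquality; Tri; tri<; tri≈; tri>)
open import Relation.Binary.PropositionalEquality
open import Relation.Binary.Structures using (IsStrictTotalOrder)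
open import Relation.Nullary using (¬_; Dec; yes; no; does; contradiction)
open import Relation.Nullary.Decidable using (map′; ¬?; _×-dec_; _⊎-dec_)

-- The standard axioms of the complete ordered field, which characterise
-- ℝ up to isomorphism.
record RealNumbers : Set₁ where
  infix  4 _<_ _≤_
  infixl 6 _+_ _-_
  infixl 7 _*_
  infix  8 -_
  field
    Carrier            : Set
    _<_                : Rel Carrier 0ℓ
    _+_ _*_            : Op₂ Carrier
    -_                 : Op₁ Carrier
    0# 1#              : Carrier
    isCommutativeRing  : IsCommutativeRing _≡_ _+_ _*_ -_ 0# 1#
    isStrictTotalOrder : IsStrictTotalOrder _≡_ _<_
    0<1                : 0# < 1#
    inverse            : ∀ x → x ≢ 0# → ∃[ y ] x * y ≡ 1#
    +-mono-<           : ∀ x y z → x < y → x + z < y + z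
    *-pos              : ∀ x y → 0# < x → 0# < y → 0# < x * y

  _≤_ : Rel Carrier 0ℓ
  x ≤ y = x < y ⊎ x ≡ y

  UpperBound : (Carrier → Set) → Carrier → Set
  UpperBound S b = ∀ x → S x → x ≤ b

  field
    supremum : (S : Carrier → Set) → ∃ S → ∃ (UpperBound S) →
               ∃[ s ] UpperBound S s × (∀ b → UpperBound S b → s ≤ b)

  _-_ : Op₂ Carrier
  x - y = x + (- y)

  open IsStrictTotalOrder isStrictTotalOrder public using (compare; _≟_; _<?_)

  commutativeRing : CommutativeRing 0ℓ 0ℓ
  commutativeRing = record { isCommutativeRing = isCommutativeRing }

  _≤?_ : ∀ x y → Dec (x ≤ y)
  x ≤? y = (x <? y) ⊎-dec (x ≟ y)

record Digraph (n : ℕ) : Set where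
  field
    #internal #edges : ℕ

  Vertex : Set
  Vertex = Fin n ⊎ Fin #internal

  Edge : Set
  Edge = Fin #edges

  field
    source target : Edge → Vertex

  boundary : Fin n → Vertex
  boundary = inj₁

  internal : Fin #internal → Vertex
  internal = inj₂

  _≟ᵥ_ : DecidableEquality Vertex
  _≟ᵥ_ = ⊎-≡-dec Fin._≟_ Fin._≟_

  outEdges inEdges : Vertex → List Edge
  outEdges v = filter (λ e → source e ≟ᵥ v) (allFin #edges)
  inEdges  v = filter (λ e → target e ≟ᵥ v) (allFin #edges)

  outdegree indegree degree : Vertex → ℕ
  outdegree v = length (outEdges v)
  indegree  v = length (inEdges v)
  degree    v = indegree v ℕ.+ outdegree v

  _⟶_ : Vertex → Vertex → Set
  u ⟶ v = ∃[ e ] source e ≡ u × target e ≡ v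

  Acyclic : Set
  Acyclic = ∀ v → ¬ TransClosure _⟶_ v v

  NoInternalSources NoInternalSinks : Set
  NoInternalSources = ∀ v → indegree  (internal v) ≢ 0
  NoInternalSinks   = ∀ v → outdegree (internal v) ≢ 0

  -- IsPath e j F : the list of edges F is a directed path with first edge
  -- e that ends at the boundary vertex b_j.
  data IsPath : Edge → Fin n → List Edge → Set where
    end : ∀ {e j} → target e ≡ boundary j → IsPath e j (e ∷ [])
    _▸_ : ∀ {e f j F} → target e ≡ source f → IsPath f j F → IsPath e j (e ∷ F)

  private
    lastStep : Edge → Fin n → List (List Edge)
    lastStep e j = if does (target e ≟ᵥ boundary j) then (e ∷ []) ∷ [] else []

  pathsUpTo : ℕ → Edge → Fin n → List (List Edge)
  pathsUpTo zero    e j = []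
  pathsUpTo (suc m) e j =
    lastStep e j ++ map (e ∷_) (concatMap (λ f → pathsUpTo m f j) (outEdges (target e)))

  -- The directed paths from e to b_j with at most #edges edges.  In an
  -- acyclic graph this list contains every directed path exactly once; see
  -- paths-sound, paths-complete and paths-unique.
  paths : Edge → Fin n → List (List Edge)
  paths = pathsUpTo #edges

  walks : Fin n → Fin n → List (List Edge)
  walks i j = concatMap (λ e → paths e j) (outEdges (boundary i))

  pathsUpTo-sound : ∀ m {e j F} → F Membership.∈ pathsUpTo m e j → IsPath e j F
  pathsUpTo-sound (suc m) {e} {j} F∈ with ∈-++⁻ (lastStep e j) F∈
  ... | inj₁ F∈l with target e ≟ᵥ boundary j | F∈l
  ...   | yes p | here refl = end p
  pathsUpTo-sound (suc m) {e} {j} F∈ | inj₂ F∈r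
    with G , G∈ , refl ← ∈-map⁻ (e ∷_) F∈r
    with f , f∈ , G∈f ← Membership.find (∈-concatMap⁻ (λ f → pathsUpTo m f j) {xs = outEdges (target e)} G∈)
    with _ , src≡ ← ∈-filter⁻ (λ e′ → source e′ ≟ᵥ target e) {xs = allFin #edges} f∈
    = sym src≡ ▸ pathsUpTo-sound m G∈f

  pathsUpTo-complete : ∀ m {e j F} → IsPath e j F → length F ℕ.≤ m → F Membership.∈ pathsUpTo m e j
  pathsUpTo-complete (suc m) {e} {j} (end p) _ with target e ≟ᵥ boundary j
  ... | yes _ = here refl
  ... | no ¬p = contradiction p ¬p
  pathsUpTo-complete (suc m) {e} {j} (_▸_ {f = f} p F) (s≤s F≤m) =
    ∈-++⁺ʳ (lastStep e j) (∈-map⁺ (e ∷_) (∈-concatMap⁺ (λ f → pathsUpTo m f j)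
      (Membership.lose (∈-filter⁺ (λ e′ → source e′ ≟ᵥ target e) (∈-allFin f) (sym p))
                 (pathsUpTo-complete m F F≤m))))

  private
    disjoint-heads : ∀ {A : Set} {e f : Edge} {j : Fin n} {F : List Edge} → e ≢ f →
                     IsPath e j F × IsPath f j F → A
    disjoint-heads e≢f (end _ , end _) = contradiction refl e≢f
    disjoint-heads e≢f (end _ , _ ▸ _) = contradiction refl e≢f
    disjoint-heads e≢f (_ ▸ _ , end _) = contradiction refl e≢f
    disjoint-heads e≢f (_ ▸ _ , _ ▸ _) = contradiction refl e≢f

  pathsUpTo-unique : ∀ m e j → Unique (pathsUpTo m e j)
  pathsUpTo-unique zero    e j = []
  pathsUpTo-unique (suc m) e j = Unique.++⁺ last-unique rest-unique last-rest
    where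
    continuations : List (List Edge)
    continuations = concatMap (λ f → pathsUpTo m f j) (outEdges (target e))

    last-unique : Unique (lastStep e j)
    last-unique with does (target e ≟ᵥ boundary j)
    ... | true  = [] ∷ []
    ... | false = []

    disjoint : ∀ {f g} → f ≢ g → Disjoint (pathsUpTo m f j) (pathsUpTo m g j)
    disjoint f≢g (F∈f , F∈g) =
      disjoint-heads f≢g (pathsUpTo-sound m F∈f , pathsUpTo-sound m F∈g)

    rest-unique : Unique (map (e ∷_) continuations)
    rest-unique = Unique.map⁺ (λ { refl → refl }) (Unique.concat⁺
      (All.map⁺ (All.universal (λ f → pathsUpTo-unique m f j) _))
      (AllPairs.map⁺ (AllPairs.map disjoint
        (Unique.filter⁺ (λ e′ → source e′ ≟ᵥ target e) (Unique.allFin⁺ #edges)))))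

    last-rest : ∀ {F} → ¬ (F Membership.∈ lastStep e j × F Membership.∈ map (e ∷_) continuations)
    last-rest (F∈l , F∈r)
      with G , G∈ , refl ← ∈-map⁻ (e ∷_) F∈r
      with f , _ , G∈f ← Membership.find (∈-concatMap⁻ (λ f → pathsUpTo m f j) {xs = outEdges (target e)} G∈)
      with does (target e ≟ᵥ boundary j) | F∈l
    ... | true | here refl with () ← pathsUpTo-sound m G∈f

  private
    lookup-path : ∀ {e j F} → IsPath e j F → (a : Fin (length F)) → toℕ a ≢ 0 →
                  TransClosure _⟶_ (source e) (source (List.lookup F a))
    lookup-path (end _) zero    a≢0 = contradiction refl a≢0
    lookup-path (_ ▸ _) zero    a≢0 = contradiction refl a≢0
    lookup-path (p ▸ end _) (suc zero) _ = [ _ , refl , p ]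
    lookup-path (p ▸ (_ ▸ _)) (suc zero) _ = [ _ , refl , p ]
    lookup-path (p ▸ F@(_ ▸ _)) (suc (suc a)) _ = (_ , refl , p) ∷ lookup-path F (suc a) λ ()

    repeat-cycle : ∀ {e j F} → IsPath e j F → (a b : Fin (length F)) → a Fin.< b →
                   TransClosure _⟶_ (source (List.lookup F a)) (source (List.lookup F b))
    repeat-cycle (end _) zero zero ()
    repeat-cycle P@(_ ▸ _) zero (suc b) _ = lookup-path P (suc b) λ ()
    repeat-cycle (_ ▸ F) (suc a) (suc b) (s≤s a<b) = repeat-cycle F a b a<b

  paths-sound : ∀ {e j F} → F Membership.∈ paths e j → IsPath e j F
  paths-sound = pathsUpTo-sound #edges

  paths-unique : ∀ e j → Unique (paths e j)
  paths-unique = pathsUpTo-unique #edges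

  paths-complete : Acyclic → ∀ {e j F} → IsPath e j F → F Membership.∈ paths e j
  paths-complete acyclic {F = F} P with length F ℕ.≤? #edges
  ... | yes F≤m = pathsUpTo-complete #edges P F≤m
  ... | no  F≰m with a , b , a<b , eq ← Fin.pigeonhole (ℕ.≰⇒> F≰m) (List.lookup F)
    = contradiction
        (subst (λ e → TransClosure _⟶_ (source (List.lookup F a)) (source e)) (sym eq)
               (repeat-cycle P a b a<b))
        (acyclic _)

elements : ∀ {n} (J : Subset n) → Vec (Fin n) ∣ J ∣
elements []            = []
elements (inside  ∷ J) = zero ∷ Vec.map suc (elements J)
elements (outside ∷ J) = Vec.map suc (elements J)

-- element J eq r is the r-th smallest element of J.
element : ∀ {n k} (J : Subset n) → ∣ J ∣ ≡ k → Fin k → Fin n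
element J eq r = Vec.lookup (elements J) (Fin.cast (sym eq) r)

StrictlyBetween : ∀ {n} → Fin n → Fin n → Fin n → Set
StrictlyBetween a b x = (a Fin.< x × x Fin.< b) ⊎ (b Fin.< x × x Fin.< a)

strictlyBetween? : ∀ {n} (a b x : Fin n) → Dec (StrictlyBetween a b x)
strictlyBetween? a b x = ((a Fin.<? x) ×-dec (x Fin.<? b)) ⊎-dec ((b Fin.<? x) ×-dec (x Fin.<? a))

#between : ∀ {n} → Subset n → Fin n → Fin n → ℕ
#between I a b = length (filter (λ x → (x ∈? I) ×-dec strictlyBetween? a b x) (allFin _))

record Matroid (k n : ℕ) : Set₁ where
  field
    Basis    : Subset n → Set
    rank     : ∀ {J} → Basis J → ∣ J ∣ ≡ k
    nonempty : ∃ Basis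
    exchange : ∀ {J J′ a} → Basis J → Basis J′ → a ∈ J → a ∉ J′ →
               ∃[ b ] b ∈ J′ × b ∉ J × Basis ((J Subset.- a) ∪ ⁅ b ⁆)

Irreducible : ∀ {k n} → Matroid k n → Set
Irreducible {n = n} M = ∀ (j : Fin n) → (∃[ J ] Basis J × j ∈ J) × (∃[ J′ ] Basis J′ × j ∉ J′)
  where open Matroid M

-- Rows are numbered from the top and columns from the left.
record LeDiagram (k n : ℕ) : Set where
  field
    rowLength : Fin k → ℕ
    fits      : ∀ r → rowLength r ℕ.≤ n ∸ k
    shape     : ∀ {r r′} → r Fin.≤ r′ → rowLength r′ ℕ.≤ rowLength r
    filling   : Fin k → Fin (n ∸ k) → Bool

  Box : Fin k → Fin (n ∸ k) → Set
  Box r c = toℕ c ℕ.< rowLength r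

  One : Fin k → Fin (n ∸ k) → Set
  One r c = filling r c ≡ true

  field
    one-in-shape : ∀ {r c} → One r c → Box r c
    le-property  : ∀ {r r′ c c′} → Box r c →
                   r′ Fin.< r → One r′ c → c′ Fin.< c → One r c′ → One r c

  columnLength : Fin (n ∸ k) → ℕ
  columnLength c = length (filter (λ r → toℕ c ℕ.<? rowLength r) (allFin k))

  -- The (zero-based) labels of the vertical border step of row r and of the
  -- horizontal border step of column c: the number of steps of the border
  -- path, starting from the north-east corner, that precede them.
  rowLabel : Fin k → ℕ
  rowLabel r = (n ∸ k ∸ rowLength r) ℕ.+ toℕ r

  columnLabel : Fin (n ∸ k) → ℕ
  columnLabel c = (n ∸ k ∸ suc (toℕ c)) ℕ.+ columnLength c

  Rightmost Lowest : Fin k → Fin (n ∸ k) → Set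
  Rightmost r c = One r c × (∀ c′ → c Fin.< c′ → ¬ One r c′)
  Lowest    r c = One r c × (∀ r′ → r Fin.< r′ → ¬ One r′ c)

  NextLeft : Fin k → Fin (n ∸ k) → Fin (n ∸ k) → Set
  NextLeft r c c′ = One r c × One r c′ × c′ Fin.< c ×
                    (∀ d → c′ Fin.< d → d Fin.< c → ¬ One r d)

  NextBelow : Fin k → Fin k → Fin (n ∸ k) → Set
  NextBelow r r′ c = One r c × One r′ c × r Fin.< r′ ×
                     (∀ d → r Fin.< d → d Fin.< r′ → ¬ One d c)

  FourValent : Fin k → Fin (n ∸ k) → Set
  FourValent r c = (∃[ c′ ] c′ Fin.< c × One r c′) × (∃[ r′ ] r′ Fin.< r × One r′ c)

  data LeVertex : Set where
    border      : Fin n → LeVertex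
    unsplit     : ∀ r c → .(One r c) → .(¬ FourValent r c) → LeVertex
    black white : ∀ r c → .(One r c) → .(FourValent r c) → LeVertex

  -- The vertex of box (r , c) at which the edges from the right and from
  -- above arrive, and the one from which the edges to the left and downwards
  -- depart.
  data Receives : LeVertex → Fin k → Fin (n ∸ k) → Set where
    unsplit : ∀ {r c} .{o : One r c} .{f : ¬ FourValent r c} → Receives (unsplit r c o f) r c
    black   : ∀ {r c} .{o : One r c} .{f : FourValent r c} → Receives (black r c o f) r c

  data Emits : LeVertex → Fin k → Fin (n ∸ k) → Set where
    unsplit : ∀ {r c} .{o : One r c} .{f : ¬ FourValent r c} → Emits (unsplit r c o f) r c
    white   : ∀ {r c} .{o : One r c} .{f : FourValent r c} → Emits (white r c o f) r c

  data LeEdge : LeVertex → LeVertex → Set where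
    fromBorder : ∀ {j r c v} → toℕ j ≡ rowLabel r → Rightmost r c → Receives v r c →
                 LeEdge (border j) v
    leftwards  : ∀ {r c c′ u v} → NextLeft r c c′ → Emits u r c → Receives v r c′ → LeEdge u v
    downwards  : ∀ {r r′ c u v} → NextBelow r r′ c → Emits u r c → Receives v r′ c → LeEdge u v
    toBorder   : ∀ {j r c u} → toℕ j ≡ columnLabel c → Lowest r c → Emits u r c →
                 LeEdge u (border j)
    split      : ∀ {r c} .{o : One r c} .{f : FourValent r c} →
                 LeEdge (black r c o f) (white r c o f)

-- Since neither graph has parallel edges, an isomorphism of directed graphs
-- is a bijection between the vertices that preserves and reflects adjacency.
record IsLeGraph (k : ℕ) {n : ℕ} (G : Digraph n) : Set where
  open Digraph G
  field
    diagram : LeDiagram k n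
  open LeDiagram diagram
  field
    vertices      : Vertex ↔ LeVertex
    keeps-labels  : ∀ j → Inverse.to vertices (boundary j) ≡ border j
    keeps-edges   : ∀ u v → (u ⟶ v) ⇔ LeEdge (Inverse.to vertices u) (Inverse.to vertices v)

module Plabic (ℝ : RealNumbers) where
  open RealNumbers ℝ

  ∑ : {A : Set} → List A → (A → Carrier) → Carrier
  ∑ xs f = foldr (λ x s → f x + s) 0# xs

  -- (-1)^ p
  sign : Parity → Carrier
  sign 0ℙ = 1#
  sign 1ℙ = - 1#

  parityℤ : ℤ → Parity
  parityℤ z = parity ℤ.∣ z ∣

  Matrix : ℕ → ℕ → Set
  Matrix k n = Fin k → Fin n → Carrier

  det : ∀ {k} → Matrix k k → Carrier
  det {zero}  A = 1#
  det {suc k} A = ∑ (allFin (suc k)) λ s →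
    sign (parity (toℕ s)) * A zero s * det (λ r t → A (suc r) (punchIn s t))

  Δ : ∀ {k n} → Matrix k n → (J : Subset n) → ∣ J ∣ ≡ k → Carrier
  Δ A J eq = det (λ r s → A r (element J eq s))

  FullRank : ∀ {k n} → Matrix k n → Set
  FullRank {k} A = ∀ (c : Fin k → Carrier) → (∀ j → ∑ (allFin k) (λ r → c r * A r j) ≡ 0#) →
                   ∀ r → c r ≡ 0#

  IsTNN : ∀ {k n} → Matrix k n → Set
  IsTNN A = FullRank A × (∀ J eq → 0# ≤ Δ A J eq)

  -- A and B have the same class in GL_k^+ \ Mat_{k,n}.
  _∼_ : ∀ {k n} → Matrix k n → Matrix k n → Set
  _∼_ {k} A B = ∃[ g ] 0# < det {k} g × (∀ r j → A r j ≡ ∑ (allFin k) (λ s → g r s * B s j))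

  _∈Cell_ : ∀ {k n} → Matrix k n → Matroid k n → Set
  A ∈Cell M = ∀ J eq → (Basis J → 0# < Δ A J eq) × (¬ Basis J → Δ A J eq ≡ 0#)
    where open Matroid M

  Point : Set
  Point = Carrier × Carrier

  infixl 6 _⊕_ _⊖_
  infixl 7 _⊛_

  _⊕_ _⊖_ : Point → Point → Point
  (a , b) ⊕ (c , d) = a + c , b + d
  (a , b) ⊖ (c , d) = a - c , b - d

  _⊛_ : Carrier → Point → Point
  t ⊛ (a , b) = t * a , t * b

  cross dot : Point → Point → Carrier
  cross (a , b) (c , d) = a * d - b * c
  dot   (a , b) (c , d) = a * c + b * d

  s : Point → Point → ℤ
  s u v with compare 0# (cross u v)
  ... | tri< _ _ _ = + 1
  ... | tri≈ _ _ _ = + 0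
  ... | tri> _ _ _ = ℤ.- (+ 1)

  OnSegment : Point → Point → Point → Set
  OnSegment p q x = ∃[ t ] 0# ≤ t × t ≤ 1# × x ≡ p ⊕ t ⊛ (q ⊖ p)

  OnRay : Point → Point → Point → Set
  OnRay b l x = ∃[ t ] 0# ≤ t × x ≡ b ⊕ t ⊛ l

  -- The ray from b in direction l meets the segment [p , q] at a point
  -- different from its starting point b.
  Crosses : Point → Point → Point → Point → Set
  Crosses b l p q = ∃[ t ] ∃[ u ]
    0# < t × 0# ≤ u × u ≤ 1# × b ⊕ t ⊛ l ≡ p ⊕ u ⊛ (q ⊖ p)

  windₗ : Point → Point → Point → ℤ
  windₗ l e f =
    if does ((s e f ℤ.≟ s e l) ×-dec (s e f ℤ.≟ s l f)) then s e f else + 0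

  -- The direction of v makes an angle in [0,π) with that of u.
  InUpperHalf : Point → Point → Set
  InUpperHalf u v = 0# < cross u v ⊎ (cross u v ≡ 0# × 0# < dot u v)

  inUpperHalf? : ∀ u v → Dec (InUpperHalf u v)
  inUpperHalf? u v = (0# <? cross u v) ⊎-dec ((cross u v ≟ 0#) ×-dec (0# <? dot u v))

  -- The signed number of times (±1 or 0) that the direction passes from
  -- below angle 0 to angle 0 (measured from u) when turning from e to f
  -- through an angle smaller than π.
  turn : Point → Point → Point → ℤ
  turn u e f with does (inUpperHalf? u e) | does (inUpperHalf? u f) | s e f
  ... | false | true  | + 1      = + 1
  ... | true  | false | -[1+ 0 ] = ℤ.- (+ 1)
  ... | _     | _     | _        = + 0

  turns : Point → List Point → ℤ
  turns u (e ∷ f ∷ es) = turn u e f ℤ.+ turns u (f ∷ es)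
  turns u _            = + 0

  -- The signed number of full turns made by the tangent direction along the
  -- polygonal path with edge vectors es, bent at its ends so that it starts
  -- and finishes in the direction u.
  fullTurns : Point → List Point → ℤ
  fullTurns u es = turns u (u ∷ es ++ u ∷ [])

  private
    R : CommutativeRing 0ℓ 0ℓ
    R = commutativeRing

    acr : AlmostCommutativeRing 0ℓ 0ℓ
    acr = fromCommutativeRing R

    open CommutativeRing R
      using (+-assoc; +-comm; +-identityˡ; +-identityʳ; -‿inverseʳ; zeroˡ; zeroʳ;
             *-identityˡ; *-identityʳ; *-assoc; ring; semiring)
    open RingProperties ring
      using (-0#≈0#; -‿+-comm; -‿distribˡ-*; -‿distribʳ-*; -‿involutive)
    open SemiringMult semiring using (×-homo-+; ×1-homo-*) renaming (_×_ to _·_)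

    ⟦_⟧ : ℤ → Carrier
    ⟦ + m ⟧      = m · 1#
    ⟦ -[1+ m ] ⟧ = - (suc m · 1#)

    neg-homo : ∀ i → ⟦ ℤ.- i ⟧ ≡ - ⟦ i ⟧
    neg-homo (+ zero)   = sym -0#≈0#
    neg-homo (+ suc m)  = refl
    neg-homo (-[1+ m ]) = sym (-‿involutive _)

    cancel : ∀ x y z → (x + y) - (x + z) ≡ y - z
    cancel x y z = begin
      (x + y) - (x + z)         ≡⟨ cong₂ _+_ (+-comm x y) (sym (-‿+-comm x z)) ⟩
      (y + x) + (- x + - z)     ≡⟨ +-assoc y x _ ⟩
      y + (x + (- x + - z))     ≡⟨ cong (λ w → y + w) (sym (+-assoc x _ _)) ⟩
      y + ((x + - x) + - z)     ≡⟨ cong (λ w → y + (w + - z)) (-‿inverseʳ x) ⟩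
      y + (0# + - z)            ≡⟨ cong (λ w → y + w) (+-identityˡ _) ⟩
      y - z                     ∎
      where open ≡-Reasoning

    ⊖-homo : ∀ m n → ⟦ m ℤ.⊖ n ⟧ ≡ m · 1# - n · 1#
    ⊖-homo zero    zero    = sym (-‿inverseʳ 0#)
    ⊖-homo zero    (suc n) = sym (+-identityˡ _)
    ⊖-homo (suc m) zero    = sym (trans (cong (λ w → suc m · 1# + w) -0#≈0#) (+-identityʳ _))
    ⊖-homo (suc m) (suc n) = trans (cong ⟦_⟧ (ℤ.[1+m]⊖[1+n]≡m⊖n m n))
                                   (trans (⊖-homo m n) (sym (cancel 1# _ _)))

    +-homo : ∀ i j → ⟦ i ℤ.+ j ⟧ ≡ ⟦ i ⟧ + ⟦ j ⟧
    +-homo (+ m)    (+ n)    = ×-homo-+ 1# m n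
    +-homo (+ m)    -[1+ n ] = ⊖-homo m (suc n)
    +-homo -[1+ m ] (+ n)    = trans (⊖-homo n (suc m)) (+-comm _ _)
    +-homo -[1+ m ] -[1+ n ] =
      trans (cong -_ (trans (cong (λ w → suc w · 1#) (sym (ℕ.+-suc m n)))
                            (×-homo-+ 1# (suc m) (suc n))))
            (sym (-‿+-comm _ _))

    pos-homo : ∀ m n → ⟦ + m ℤ.* + n ⟧ ≡ ⟦ + m ⟧ * ⟦ + n ⟧
    pos-homo m n = trans (cong ⟦_⟧ (sym (ℤ.pos-* m n))) (×1-homo-* m n)

    *-homo : ∀ i j → ⟦ i ℤ.* j ⟧ ≡ ⟦ i ⟧ * ⟦ j ⟧
    *-homo (+ m)    (+ n)    = pos-homo m n
    *-homo (+ m)    -[1+ n ] =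
      trans (cong ⟦_⟧ (sym (ℤ.neg-distribʳ-* (+ m) (+ suc n))))
      (trans (neg-homo (+ m ℤ.* + suc n))
      (trans (cong -_ (pos-homo m (suc n))) (-‿distribʳ-* _ _)))
    *-homo -[1+ m ] (+ n)    =
      trans (cong ⟦_⟧ (sym (ℤ.neg-distribˡ-* (+ suc m) (+ n))))
      (trans (neg-homo (+ suc m ℤ.* + n))
      (trans (cong -_ (pos-homo (suc m) n)) (-‿distribˡ-* _ _)))
    *-homo -[1+ m ] -[1+ n ] =
      trans (pos-homo (suc m) (suc n))
      (trans (sym (-‿involutive _))
      (trans (cong -_ (-‿distribˡ-* _ _)) (-‿distribʳ-* _ _)))

    morphism : ℤ.+-*-rawRing -Raw-AlmostCommutative⟶ acr
    morphism = record
      { ⟦_⟧ = ⟦_⟧ ; +-homo = +-homo ; *-homo = *-homo ; -‿homo = neg-homo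
      ; 0-homo = refl ; 1-homo = +-identityʳ 1# }

    coeff≟ : ∀ i j → Maybe (⟦ i ⟧ ≡ ⟦ j ⟧)
    coeff≟ i j with i ℤ.≟ j
    ... | yes eq = just (cong ⟦_⟧ eq)
    ... | no  _  = nothing

    open Algebra.Solver.Ring ℤ.+-*-rawRing acr morphism coeff≟
      using (solve; _:=_; _:+_; _:*_; _:-_; :-_; con)

    open ≡-Reasoning

    open IsStrictTotalOrder isStrictTotalOrder using () renaming (trans to <-trans; irrefl to <-irrefl)

    ≮0⇒≤0 : ∀ {x} → ¬ 0# < x → x ≤ 0#
    ≮0⇒≤0 {x} ≮ with compare 0# x
    ... | tri< 0<x _ _ = contradiction 0<x ≮
    ... | tri≈ _ 0≡x _ = inj₂ (sym 0≡x)
    ... | tri> _ _ x<0 = inj₁ x<0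

    +-≤0 : ∀ {x y} → x ≤ 0# → y ≤ 0# → ¬ 0# < x + y
    +-≤0 {x} {y} (inj₁ x<0) y≤0 0<x+y with y≤0 | subst (x + y <_) (+-identityˡ y) (+-mono-< x 0# y x<0)
    ... | inj₁ y<0  | x+y<y = <-irrefl refl (<-trans 0<x+y (<-trans x+y<y y<0))
    ... | inj₂ refl | x+y<y = <-irrefl refl (<-trans 0<x+y x+y<y)
    +-≤0 {y = y} (inj₂ refl) y≤0 0<y with y≤0 | subst (0# <_) (+-identityˡ y) 0<y
    ... | inj₁ y<0  | 0<y′ = <-irrefl refl (<-trans 0<y′ y<0)
    ... | inj₂ refl | 0<0  = <-irrefl refl 0<0

    <⇒0<- : ∀ {x y} → x < y → 0# < y - x
    <⇒0<- {x} {y} x<y = subst (_< y - x) (-‿inverseʳ x) (+-mono-< x y (- x) x<y)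

    ≤⇒0≤- : ∀ {x y} → x ≤ y → 0# ≤ y - x
    ≤⇒0≤- (inj₁ x<y)      = inj₁ (<⇒0<- x<y)
    ≤⇒0≤- {x} (inj₂ refl) = inj₂ (sym (-‿inverseʳ x))

    *-≤0 : ∀ {x y} → 0# ≤ x → y ≤ 0# → x * y ≤ 0#
    *-≤0 {x} {y} (inj₁ 0<x) (inj₁ y<0) = inj₁
      (subst₂ _<_ (+-identityˡ _) (solve 2 (λ x y → x :* (con (+ 0) :- y) :+ x :* y := con (+ 0)) refl x y)
        (+-mono-< 0# (x * (0# - y)) (x * y) (*-pos x (0# - y) 0<x (<⇒0<- y<0))))
    *-≤0 {y = y} (inj₂ refl) _ = inj₂ (zeroˡ y)
    *-≤0 {x} _ (inj₂ refl)     = inj₂ (zeroʳ x)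

    OnUnitInterval : (α β γ δ : Carrier) → Carrier → Set
    OnUnitInterval α β γ δ u = 0# ≤ u × u ≤ 1# × α + u * β ≡ 0# × 0# < γ + u * δ

    module Sloped (α β γ δ i : Carrier) (βi≡1 : β * i ≡ 1#) where
      u₀ : Carrier
      u₀ = - (α * i)

      root : α + u₀ * β ≡ 0#
      root = begin
        α + - (α * i) * β   ≡⟨ solve 3 (λ α β i → α :+ (:- (α :* i)) :* β := α :- α :* (β :* i)) refl α β i ⟩
        α - α * (β * i)     ≡⟨ cong (λ w → α - α * w) βi≡1 ⟩
        α - α * 1#          ≡⟨ cong (λ w → α - w) (*-identityʳ α) ⟩
        α - α               ≡⟨ -‿inverseʳ α ⟩
        0#                  ∎

      unique : ∀ {u} → α + u * β ≡ 0# → u ≡ u₀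
      unique {u} z = begin
        u                             ≡⟨ *-identityʳ u ⟨
        u * 1#                        ≡⟨ cong (u *_) βi≡1 ⟨
        u * (β * i)                   ≡⟨ solve 4 (λ α β i u → u :* (β :* i) := (α :+ u :* β) :* i :- α :* i) refl α β i u ⟩
        (α + u * β) * i - α * i       ≡⟨ cong (λ w → w * i - α * i) z ⟩
        0# * i - α * i                ≡⟨ solve 2 (λ α i → con (+ 0) :* i :- α :* i := :- (α :* i)) refl α i ⟩
        u₀                            ∎

      InRange : Set
      InRange = 0# ≤ u₀ × u₀ ≤ 1# × 0# < γ + u₀ * δ

      inRange? : Dec InRange
      inRange? = (0# ≤? u₀) ×-dec (u₀ ≤? 1#) ×-dec (0# <? γ + u₀ * δ)

      to : InRange → ∃ (OnUnitInterval α β γ δ)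
      to (p , q , r) = u₀ , p , q , root , r

      from : ∃ (OnUnitInterval α β γ δ) → InRange
      from (u , p , q , z , r) =
        subst (λ u → 0# ≤ u × u ≤ 1# × 0# < γ + u * δ) (unique z) (p , q , r)

      decide : Dec (∃ (OnUnitInterval α β γ δ))
      decide = map′ to from inRange?

    x+y0≡x : ∀ x y → x + y * 0# ≡ x
    x+y0≡x x y = trans (cong (λ w → x + w) (zeroʳ y)) (+-identityʳ x)

    flat? : ∀ γ δ → Dec (∃ (OnUnitInterval 0# 0# γ δ))
    flat? γ δ with 0# <? γ | 0# <? γ + δ
    ... | yes 0<γ | _ = yes (0# , inj₂ refl , inj₁ 0<1 , x+y0≡x 0# 0# ,
      subst (0# <_) (sym (trans (cong (λ w → γ + w) (zeroˡ δ)) (+-identityʳ γ))) 0<γ)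
    ... | no _ | yes 0<γ+δ = yes (1# , inj₁ 0<1 , inj₂ refl , x+y0≡x 0# 1# ,
      subst (λ w → 0# < γ + w) (sym (*-identityˡ δ)) 0<γ+δ)
    ... | no 0≮γ | no 0≮γ+δ = no λ (u , 0≤u , u≤1 , _ , r) →
      +-≤0 (*-≤0 (≤⇒0≤- u≤1) (≮0⇒≤0 0≮γ)) (*-≤0 0≤u (≮0⇒≤0 0≮γ+δ))
        (subst (0# <_) (convex u) r)
      where
      convex : ∀ u → γ + u * δ ≡ (1# - u) * γ + u * (γ + δ)
      convex u = trans (cong (_+ u * δ) (sym (*-identityˡ γ)))
        (solve 4 (λ e u γ δ → e :* γ :+ u :* δ := (e :- u) :* γ :+ u :* (γ :+ δ)) refl 1# u γ δ)

    onUnitInterval? : ∀ α β γ δ → Dec (∃ (OnUnitInterval α β γ δ))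
    onUnitInterval? α β γ δ with β ≟ 0# | α ≟ 0#
    ... | no β≢0   | _        = Sloped.decide α β γ δ (proj₁ (inverse β β≢0)) (proj₂ (inverse β β≢0))
    ... | yes refl | yes refl = flat? γ δ
    ... | yes refl | no α≢0   = no λ (u , _ , _ , z , _) → α≢0 (trans (sym (x+y0≡x α u)) z)

  module Intersection
    (l m : Point) (j : Carrier) (lmj≡1 : cross l m * j ≡ 1#) (b p q : Point) where
    private
      l₁ l₂ m₁ m₂ b₁ b₂ p₁ p₂ : Carrier
      l₁ = proj₁ l
      l₂ = proj₂ l
      m₁ = proj₁ m
      m₂ = proj₂ m
      b₁ = proj₁ b
      b₂ = proj₂ b
      p₁ = proj₁ p
      p₂ = proj₂ p

    c d : Point
    c = p ⊖ b
    d = q ⊖ p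

    -- The vector from b to the point of the segment with parameter u.
    v : Carrier → Point
    v u = (p ⊕ u ⊛ d) ⊖ b

    cross-v : ∀ u z → cross c z + u * cross d z ≡ cross (v u) z
    cross-v u z = trans
      (solve 7 (λ c₁ c₂ d₁ d₂ u z₁ z₂ →
         (c₁ :* z₂ :- c₂ :* z₁) :+ u :* (d₁ :* z₂ :- d₂ :* z₁) :=
         (c₁ :+ u :* d₁) :* z₂ :- (c₂ :+ u :* d₂) :* z₁)
         refl (proj₁ c) (proj₂ c) (proj₁ d) (proj₂ d) u z₁ z₂)
      (cong₂ (λ x y → x * z₂ - y * z₁) (swap p₁ b₁ _) (swap p₂ b₂ _))
      where
      z₁ z₂ : Carrier
      z₁ = proj₁ z
      z₂ = proj₂ z

      swap : ∀ p b x → (p - b) + x ≡ (p + x) - b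
      swap = solve 3 (λ p b x → (p :- b) :+ x := (p :+ x) :- b) refl

    cross-eq : ∀ t u → b ⊕ t ⊛ l ≡ p ⊕ u ⊛ d → ∀ z → cross c z + u * cross d z ≡ t * cross l z
    cross-eq t u eq z = begin
      cross c z + u * cross d z                     ≡⟨ cross-v u z ⟩
      cross (v u) z                                 ≡⟨ cong (λ x → cross (x ⊖ b) z) eq ⟨
      cross ((b ⊕ t ⊛ l) ⊖ b) z                     ≡⟨ cong₂ (λ x y → x * z₂ - y * z₁) (drop b₁ _) (drop b₂ _) ⟩
      (t * l₁) * z₂ - (t * l₂) * z₁                 ≡⟨ solve 5 (λ l₁ l₂ t z₁ z₂ →
                                                         (t :* l₁) :* z₂ :- (t :* l₂) :* z₁ :=
                                                         t :* (l₁ :* z₂ :- l₂ :* z₁)) refl l₁ l₂ t z₁ z₂ ⟩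
      t * cross l z                                 ∎
      where
      z₁ z₂ : Carrier
      z₁ = proj₁ z
      z₂ = proj₂ z

      drop : ∀ b x → (b + x) - b ≡ x
      drop = solve 2 (λ b x → (b :+ x) :- b := x) refl

    root : ∀ t u → b ⊕ t ⊛ l ≡ p ⊕ u ⊛ d → cross c l + u * cross d l ≡ 0#
    root t u eq = trans (cross-eq t u eq l)
      (solve 3 (λ l₁ l₂ t → t :* (l₁ :* l₂ :- l₂ :* l₁) := con (+ 0)) refl l₁ l₂ t)

    distrib-j : ∀ x y u → (x + u * y) * j ≡ x * j + u * (y * j)
    distrib-j x y u =
      solve 4 (λ x y u j → (x :+ u :* y) :* j := x :* j :+ u :* (y :* j)) refl x y u j

    time : ∀ t u → b ⊕ t ⊛ l ≡ p ⊕ u ⊛ d → t ≡ cross c m * j + u * (cross d m * j)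
    time t u eq = begin
      t                                       ≡⟨ *-identityʳ t ⟨
      t * 1#                                  ≡⟨ cong (t *_) lmj≡1 ⟨
      t * (cross l m * j)                     ≡⟨ *-assoc t _ j ⟨
      t * cross l m * j                       ≡⟨ cong (_* j) (cross-eq t u eq m) ⟨
      (cross c m + u * cross d m) * j         ≡⟨ distrib-j _ _ u ⟩
      cross c m * j + u * (cross d m * j)     ∎

    -- If x is parallel to l then x = (cross x m / cross l m) l.
    parallel : ∀ x → cross x l ≡ 0# → (cross x m * j) ⊛ l ≡ x
    parallel x z = cong₂ _,_
      (trans (solve 7 (λ x₁ x₂ l₁ l₂ m₁ m₂ j →
         ((x₁ :* m₂ :- x₂ :* m₁) :* j) :* l₁ :=
         ((l₁ :* m₂ :- l₂ :* m₁) :* j) :* x₁ :+ (x₁ :* l₂ :- x₂ :* l₁) :* (m₁ :* j))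
         refl x₁ x₂ l₁ l₂ m₁ m₂ j) (simplify x₁ m₁))
      (trans (solve 7 (λ x₁ x₂ l₁ l₂ m₁ m₂ j →
         ((x₁ :* m₂ :- x₂ :* m₁) :* j) :* l₂ :=
         ((l₁ :* m₂ :- l₂ :* m₁) :* j) :* x₂ :+ (x₁ :* l₂ :- x₂ :* l₁) :* (m₂ :* j))
         refl x₁ x₂ l₁ l₂ m₁ m₂ j) (simplify x₂ m₂))
      where
      x₁ x₂ : Carrier
      x₁ = proj₁ x
      x₂ = proj₂ x

      simplify : ∀ xᵢ mᵢ → (cross l m * j) * xᵢ + cross x l * (mᵢ * j) ≡ xᵢ
      simplify xᵢ mᵢ = begin
        (cross l m * j) * xᵢ + cross x l * (mᵢ * j)   ≡⟨ cong₂ (λ y w → y * xᵢ + w * (mᵢ * j)) lmj≡1 z ⟩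
        1# * xᵢ + 0# * (mᵢ * j)                       ≡⟨ cong₂ _+_ (*-identityˡ xᵢ) (zeroˡ _) ⟩
        xᵢ + 0#                                       ≡⟨ +-identityʳ xᵢ ⟩
        xᵢ                                            ∎

    meet : ∀ u → cross c l + u * cross d l ≡ 0# →
           b ⊕ (cross c m * j + u * (cross d m * j)) ⊛ l ≡ p ⊕ u ⊛ d
    meet u z = begin
      b ⊕ (cross c m * j + u * (cross d m * j)) ⊛ l
        ≡⟨ cong (λ t → b ⊕ t ⊛ l) (trans (sym (distrib-j _ _ u)) (cong (_* j) (cross-v u m))) ⟩
      b ⊕ (cross (v u) m * j) ⊛ l
        ≡⟨ cong (b ⊕_) (parallel (v u) (trans (sym (cross-v u l)) z)) ⟩
      b ⊕ v u
        ≡⟨ cong₂ _,_ (restore b₁ _) (restore b₂ _) ⟩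
      p ⊕ u ⊛ d ∎
      where
      restore : ∀ b x → b + (x - b) ≡ x
      restore = solve 2 (λ b x → b :+ (x :- b) := x) refl

    Root : Carrier → Set
    Root = OnUnitInterval (cross c l) (cross d l) (cross c m * j) (cross d m * j)

    to : ∃ Root → Crosses b l p q
    to (u , 0≤u , u≤1 , z , 0<t) =
      cross c m * j + u * (cross d m * j) , u , 0<t , 0≤u , u≤1 , meet u z

    from : Crosses b l p q → ∃ Root
    from (t , u , 0<t , 0≤u , u≤1 , eq) =
      u , 0≤u , u≤1 , root t u eq , subst (0# <_) (time t u eq) 0<t

    decide : Dec (Crosses b l p q)
    decide = map′ to from (onUnitInterval? _ _ _ _)

  private
    cross-antisym : ∀ u v → cross u v ≡ - cross v u
    cross-antisym (u₁ , u₂) (v₁ , v₂) =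
      solve 4 (λ u₁ u₂ v₁ v₂ → u₁ :* v₂ :- u₂ :* v₁ := :- (v₁ :* u₂ :- v₂ :* u₁)) refl u₁ u₂ v₁ v₂

  -- The vector m only has to witness that l is nonzero.
  crosses? : ∀ {l m} → cross l m ≢ 0# → ∀ b p q → Dec (Crosses b l p q)
  crosses? {l} {m} l≢0 = Intersection.decide l m (proj₁ i) (proj₂ i)
    where
    i : ∃[ j ] cross l m * j ≡ 1#
    i = inverse (cross l m) l≢0

  data Colour : Set where
    white black : Colour

  record PlabicGraph (k n : ℕ) : Set where
    field
      digraph : Digraph n
    open Digraph digraph public
    field
      I               : Subset n
      ∣I∣≡k           : ∣ I ∣ ≡ k
      boundary-source : ∀ {j} → j ∈ I → indegree (boundary j) ≡ 0 × outdegree (boundary j) ≡ 1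
      boundary-sink   : ∀ {j} → j ∉ I → indegree (boundary j) ≡ 1 × outdegree (boundary j) ≡ 0
      valency         : ∀ v → degree (internal v) ≡ 2 ⊎ degree (internal v) ≡ 3
      colour          : Fin #internal → Colour
      white-vertex    : ∀ v → colour v ≡ white → indegree (internal v) ≡ 1
      black-vertex    : ∀ v → colour v ≡ black → outdegree (internal v) ≡ 1
      not-isolated    : ∀ v → ∃[ j ] EqClosure _⟶_ (internal v) (boundary j)
      -- The drawing.  A disk with all b_j on a straight interval of its
      -- boundary is represented by the half-plane bounded by the line of
      -- that interval: running along the boundary clockwise, in the
      -- direction axis, one has the interior on the right-hand side.
      position        : Vertex → Point
      injective       : ∀ {u v} → position u ≡ position v → u ≡ v
      origin axis     : Point
      abscissa        : Fin n → Carrier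
      on-axis         : ∀ j → position (boundary j) ≡ origin ⊕ abscissa j ⊛ axis
      clockwise       : ∀ {i j} → i Fin.< j → abscissa i < abscissa j
      inside-disk     : ∀ v → cross axis (position (internal v) ⊖ origin) < 0#
      no-loops        : ∀ e → source e ≢ target e

    Endpoint : Vertex → Edge → Set
    Endpoint v e = v ≡ source e ⊎ v ≡ target e

    OnEdge : Point → Edge → Set
    OnEdge x e = OnSegment (position (source e)) (position (target e)) x

    -- Since every vertex is an endpoint of some edge, this also says that an
    -- edge contains no vertices besides its endpoints.
    field
      planar : ∀ {e f} → e ≢ f → ∀ x → OnEdge x e → OnEdge x f →
               ∃[ v ] x ≡ position v × Endpoint v e × Endpoint v f

    -- The index i_r of the r-th boundary source.
    i : Fin k → Fin n
    i = element I ∣I∣≡k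

    Ī : List (Fin n)
    Ī = filter (λ j → ¬? (j ∈? I)) (allFin n)

    vector : Edge → Point
    vector e = position (target e) ⊖ position (source e)

    IsInternalEdge : Edge → Set
    IsInternalEdge e = (∃[ u ] source e ≡ internal u) × (∃[ v ] target e ≡ internal v)

    -- For a directed walk from b_a to b_b.  The end directions of the smoothed
    -- walk are both taken to be that of the vector from b_a to b_b, so that
    -- the index of a walk without self-intersections is 0.
    wind-top : Fin n → Fin n → List Edge → ℤ
    wind-top a b P = fullTurns (position (boundary b) ⊖ position (boundary a)) (map vector P)

  record PlabicNetwork (k n : ℕ) : Set where
    field
      graph : PlabicGraph k n
    open PlabicGraph graph public
    field
      weight   : Edge → Carrier
      positive : ∀ e → 0# < weight e

    w : List Edge → Carrier
    w = foldr (λ e x → weight e * x) 1#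

    -- The representative matrix attached to an acyclic network.
    boundaryMatrix : Matrix k n
    boundaryMatrix r j with j ∈? I
    ... | yes _ = if does (i r Fin.≟ j) then 1# else 0#
    ... | no  _ = sign (parity (#between I (i r) j)) *
                  ∑ (walks (i r) j) (λ P → sign (parityℤ (wind-top (i r) j P)) * w P)

    Represents : Matrix k n → Set
    Represents A = A ∼ boundaryMatrix

    RepresentsIrreduciblePoint : Set₁
    RepresentsIrreduciblePoint =
      ∃[ A ] IsTNN A × Represents A × (∃[ M ] Irreducible M × A ∈Cell M)

  IsLeNetwork : ∀ {k n} → PlabicNetwork k n → Set
  IsLeNetwork {k} N = IsLeGraph k digraph
    where open PlabicNetwork N

  record GaugeRayDirection {k n} (G : PlabicGraph k n) : Set where
    open PlabicGraph G
    field
      l                 : Point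
      points-inside     : cross axis l < 0#
      not-parallel      : ∀ e → IsInternalEdge e → cross (vector e) l ≢ 0#
      avoids-internal   : ∀ j v → ¬ OnRay (position (boundary j)) l (position (internal v))

    MeetsRay : Edge → Fin k → Set
    MeetsRay e r = Crosses (position (boundary (i r))) l (position (source e)) (position (target e))

    meetsRay? : ∀ e r → Dec (MeetsRay e r)
    meetsRay? e r = crosses? {m = axis} l≢0 _ _ _
      where
      l≢0 : cross l axis ≢ 0#
      l≢0 z = IsStrictTotalOrder.irrefl isStrictTotalOrder (antisymmetric z) points-inside
        where
        antisymmetric : cross l axis ≡ 0# → cross axis l ≡ 0#
        antisymmetric z = trans (cross-antisym axis l) (trans (cong -_ z) -0#≈0#)

    int : Edge → ℕ
    int e = length (filter (meetsRay? e) (allFin k))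

    windₚ : List Edge → ℤ
    windₚ (e ∷ f ∷ P) = windₗ l (vector e) (vector f) ℤ.+ windₚ (f ∷ P)
    windₚ _           = + 0

    intₚ : List Edge → ℕ
    intₚ = foldr (λ e m → int e ℕ.+ m) 0

    -- The parity of wind(P) + int(P).
    windInt : List Edge → Parity
    windInt P = parityℤ (windₚ P ℤ.+ (+ intₚ P))

  module _ {k n} (N : PlabicNetwork k n) (𝔩 : GaugeRayDirection (PlabicNetwork.graph N)) where
    open PlabicNetwork N
    open GaugeRayDirection 𝔩

    -- The sum over the list paths e j is the sum over all directed paths when
    -- the network is acyclic.
    edgeVector : Edge → Fin n → Carrier
    edgeVector e j = ∑ (paths e j) λ P → sign (windInt P) * w P

    canonicalBasis : Fin n → Fin n → Carrier
    canonicalBasis j m = if does (j Fin.≟ m) then 1# else 0#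

    EdgeVectorFormula : Set
    EdgeVectorFormula = Σ[ σ ∈ (Edge → Fin n → Parity) ] ∀ (e : Edge) →
      (∀ (j : Fin n) → j ∉ I → ∀ F → IsPath e j F → windInt F ≡ σ e j) ×
      (∀ m → edgeVector e m ≡
             ∑ Ī (λ j → ∑ (paths e j) (λ F → sign (windInt F) * w F) * canonicalBasis j m)) ×
      (∀ m → edgeVector e m ≡
             ∑ Ī (λ j → (sign (σ e j) * ∑ (paths e j) w) * canonicalBasis j m))

    EdgeVectorsNonNull : Set
    EdgeVectorsNonNull = ∀ e → ¬ (∀ m → edgeVector e m ≡ 0#)

{-# OPTIONS --safe #-}

-- Mod 2, wind counts the times the direction of a path passes through l.  For
-- a path that starts at a boundary vertex this count depends only on its first
-- edge and its end, by Hopf's proof of the Umlaufsatz: deform the tangent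
-- direction to the direction of a secant; since a path of an acyclic planar
-- network does not meet itself, no secant vanishes during the deformation,
-- and secants through the two ends stay in a half-plane.  Without internal
-- sources every edge e is reached from the boundary, and prepending such a path
-- to the paths from e to b_j changes all their winding numbers by the same
-- amount.  Mod 2, int counts changes of side with respect to the lines of the
-- rays, so it depends only on the first edge and the end as well.

module Submission where

open import Defs
open import Algebra.Bundles using (CommutativeRing)
import Algebra.Properties.Ring as RingProperties
import Algebra.Properties.Semiring.Mult as SemiringMult
import Algebra.Solver.Ring
import Algebra.Solver.Ring.Simple
open import Algebra.Solver.Ring.AlmostCommutativeRing
  using (fromCommutativeRing; _-Raw-AlmostCommutative⟶_)
open import Data.Bool as Bool using (true; if_then_else_)
open import Data.Fin as Fin using (Fin; zero; suc; toℕ)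
import Data.Fin.Induction as Fin
import Data.Fin.Properties as Fin
open import Data.Fin.Subset using (Subset; inside; outside; _∈_; _∉_)
open import Data.Fin.Subset.Properties using (_∈?_)
open import Data.Integer as ℤ using (ℤ; +_; -[1+_])
import Data.Integer.Properties as ℤ
open import Data.List using (List; []; _∷_; length; filter; allFin)
import Data.List.Membership.Propositional as List
open import Data.List.Membership.Propositional.Properties using (∈-filter⁺; ∈-filter⁻; ∈-allFin)
open import Data.List.Relation.Unary.All as All using ()
open import Data.List.Relation.Unary.AllPairs using (_∷_)
open import Data.List.Relation.Unary.Any using (here; there)
open import Data.List.Relation.Unary.Unique.Propositional using (Unique)
import Data.List.Relation.Unary.Unique.Propositional.Properties as Unique
import Data.Maybe
open import Data.Nat as ℕ using (ℕ; zero; suc; _∸_; parity)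
import Data.Nat.Properties as ℕ
open import Data.Parity as ℙ using (Parity; 0ℙ; 1ℙ)
import Data.Parity.Properties as ℙ
open import Data.Product using (∃-syntax; _×_; _,_; proj₁; proj₂)
open import Data.Sum using (_⊎_; inj₁; inj₂; map₂)
open import Data.Sum.Properties using (inj₁-injective)
open import Data.Vec as Vec using (_∷_; here; there)
open import Data.Vec.Properties using (lookup-map)
open import Function using (_∘_)
open import Function.Bundles using (Inverse; Equivalence)
open import Induction.WellFounded using (Acc; acc)
open import Relation.Binary.Construct.Closure.Transitive using (TransClosure; [_]; _∷_; _∷ʳ_; _++_)
open import Relation.Binary.Definitions using (tri<; tri≈; tri>)
open import Relation.Binary.PropositionalEquality
open import Relation.Binary.Structures using (IsStrictPartialOrder; IsStrictTotalOrder)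
open import Relation.Nullary using (¬_; Dec; yes; no; does; contradiction; recompute)
open import Relation.Nullary.Decidable using (dec-true; dec-false; dec⇒maybe; ¬?; _×-dec_)
open import Relation.Unary using (Decidable)

-- Parities

-- Angles and limits are avoided: a change of direction is measured by `χ`, which behaves like a
-- cocycle, being additive on a triangle of vectors whose hull misses the origin. This turns Hopf's
-- deformation into a finite sum. The secant from parameter t on one edge to parameter u on another
-- is affine in (t, u), so a pair of edges gives a square cell that is cut into two triangles, and
-- the secant vanishes in the cell only if the edges meet. For consecutive edges it does vanish, at
-- t = 1 and u = 0; there only the half t ≤ u of the cell is used, which leaves this corner out. All
-- cells together fill a triangle: along its diagonal `χ` adds up to the winding, along one side to
-- the turning seen from the starting point, and along the other, where every secant points at b_j,
-- to zero. The view from the starting point is under control only if that point lies on the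
-- boundary line; this is why an internal edge needs a prefix.

module ParitySolver = Algebra.Solver.Ring.Simple (fromCommutativeRing ℙ.+-*-commutativeRing) ℙ._≟_

parity-∣⊖∣ : ∀ m n → parity ℤ.∣ m ℤ.⊖ n ∣ ≡ parity m ℙ.+ parity n
parity-∣⊖∣ zero    zero    = refl
parity-∣⊖∣ zero    (suc n) = refl
parity-∣⊖∣ (suc m) zero    = sym (ℙ.+-identityʳ _)
parity-∣⊖∣ (suc m) (suc n) = begin
  parity ℤ.∣ suc m ℤ.⊖ suc n ∣                  ≡⟨ cong (parity ∘ ℤ.∣_∣) (ℤ.[1+m]⊖[1+n]≡m⊖n m n) ⟩
  parity ℤ.∣ m ℤ.⊖ n ∣                          ≡⟨ parity-∣⊖∣ m n ⟩
  parity m ℙ.+ parity n                         ≡⟨ solve 2 (λ x y → x :+ y := (con 1ℙ :+ x) :+ (con 1ℙ :+ y)) refl (parity m) (parity n) ⟩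
  (1ℙ ℙ.+ parity m) ℙ.+ (1ℙ ℙ.+ parity n)       ≡⟨ cong₂ ℙ._+_ (ℙ.+-homo-+ 1 m) (ℙ.+-homo-+ 1 n) ⟨
  parity (suc m) ℙ.+ parity (suc n)             ∎
  where
  open ParitySolver using (solve; con; _:=_; _:+_)
  open ≡-Reasoning

parity-∣+∣ : ∀ i j → parity ℤ.∣ i ℤ.+ j ∣ ≡ parity ℤ.∣ i ∣ ℙ.+ parity ℤ.∣ j ∣
parity-∣+∣ (+ m)    (+ n)    = ℙ.+-homo-+ m n
parity-∣+∣ (+ m)    -[1+ n ] = parity-∣⊖∣ m (suc n)
parity-∣+∣ -[1+ m ] (+ n)    = trans (parity-∣⊖∣ n (suc m)) (ℙ.+-comm (parity n) _)
parity-∣+∣ -[1+ m ] -[1+ n ] =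
  trans (cong (parity ∘ suc) (sym (ℕ.+-suc m n))) (ℙ.+-homo-+ (suc m) (suc n))

telescope : ∀ p q r → (p ℙ.+ q) ℙ.+ (q ℙ.+ r) ≡ p ℙ.+ r
telescope = solve 3 (λ p q r → (p :+ q) :+ (q :+ r) := p :+ r) refl
  where open ParitySolver using (solve; _:=_; _:+_)

elements-∈ : ∀ {n} (J : Subset n) r → Vec.lookup (elements J) r ∈ J
elements-∈ (inside  ∷ J) zero    = here
elements-∈ (inside  ∷ J) (suc r) = subst (_∈ inside ∷ J) (sym (lookup-map r suc (elements J))) (there (elements-∈ J r))
elements-∈ (outside ∷ J) r       = subst (_∈ outside ∷ J) (sym (lookup-map r suc (elements J))) (there (elements-∈ J r))

length≢0 : ∀ {A : Set} {x : A} {xs : List A} → x List.∈ xs → length xs ≢ 0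
length≢0 (here _)  ()
length≢0 (there _) ()

nonempty : ∀ {A : Set} (xs : List A) → length xs ≢ 0 → ∃[ x ] x List.∈ xs
nonempty []       ≢0 = contradiction refl ≢0
nonempty (x ∷ xs) _  = x , here refl

sumℙ : ∀ {A : Set} → (A → Parity) → List A → Parity
sumℙ φ []       = 0ℙ
sumℙ φ (x ∷ xs) = φ x ℙ.+ sumℙ φ xs

sumℙ-+ : ∀ {A : Set} (φ ψ : A → Parity) xs → sumℙ (λ x → φ x ℙ.+ ψ x) xs ≡ sumℙ φ xs ℙ.+ sumℙ ψ xs
sumℙ-+ φ ψ []       = refl
sumℙ-+ φ ψ (x ∷ xs) = trans (cong (φ x ℙ.+ ψ x ℙ.+_) (sumℙ-+ φ ψ xs))
  (solve 4 (λ a b c d → (a :+ b) :+ (c :+ d) := (a :+ c) :+ (b :+ d)) refl (φ x) (ψ x) _ _)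
  where open ParitySolver using (solve; _:=_; _:+_)

parity-length-filter : ∀ {A : Set} {P : A → Set} (P? : Decidable P) (φ : A → Parity) →
  (∀ x → P x → φ x ≡ 1ℙ) → (∀ x → ¬ P x → φ x ≡ 0ℙ) →
  ∀ xs → parity (length (filter P? xs)) ≡ sumℙ φ xs
parity-length-filter P? φ yes⇒1 no⇒0 []       = refl
parity-length-filter P? φ yes⇒1 no⇒0 (x ∷ xs) with P? x
... | yes p rewrite yes⇒1 x p =
  trans (ℙ.+-homo-+ 1 (length (filter P? xs))) (cong (1ℙ ℙ.+_) (parity-length-filter P? φ yes⇒1 no⇒0 xs))
... | no ¬p rewrite no⇒0 x ¬p = parity-length-filter P? φ yes⇒1 no⇒0 xs

≡⇒+≡0 : ∀ {p q} → p ≡ q → p ℙ.+ q ≡ 0ℙ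
≡⇒+≡0 {p} refl = ℙ.p+p≡0ℙ p

≢⇒+≡1 : ∀ {p q} → p ≢ q → p ℙ.+ q ≡ 1ℙ
≢⇒+≡1 {0ℙ} {0ℙ} p≢q = contradiction refl p≢q
≢⇒+≡1 {0ℙ} {1ℙ} p≢q = refl
≢⇒+≡1 {1ℙ} {0ℙ} p≢q = refl
≢⇒+≡1 {1ℙ} {1ℙ} p≢q = contradiction refl p≢q

headParity : ∀ {A : Set} → (A → Parity) → List A → Parity
headParity φ []      = 0ℙ
headParity φ (x ∷ _) = φ x

headParity-const : ∀ {A : Set} {x : A} {xs} (φ : A → Parity) → x List.∈ xs →
                   (∀ {y} → y List.∈ xs → φ x ≡ φ y) → φ x ≡ headParity φ xs
headParity-const {xs = _ ∷ _} φ _ const = const (here refl)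

-- Ordered fields

module OrderedField (ℝ : RealNumbers) where
  open RealNumbers ℝ
  open CommutativeRing commutativeRing
    using (+-assoc; +-comm; +-identityˡ; +-identityʳ; -‿inverseʳ; zeroˡ; zeroʳ;
           *-identityˡ; ring; semiring)
  open RingProperties ring
    using (-‿+-comm; -‿distribˡ-*; -‿distribʳ-*; -‿involutive)
  open RingProperties ring public using (-0#≈0#)
  open SemiringMult semiring using (×-homo-+; ×1-homo-*) renaming (_×_ to _·_)
  open IsStrictTotalOrder isStrictTotalOrder using () renaming (trans to <-trans; irrefl to <-irrefl)
  open ≡-Reasoning

  -- The canonical homomorphism from the integers. It gives the ring solver coefficients with
  -- decidable, computing equality.
  ⟦_⟧ : ℤ → Carrier
  ⟦ + m ⟧      = m · 1#
  ⟦ -[1+ m ] ⟧ = - (suc m · 1#)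

  ⟦⟧-neg : ∀ i → ⟦ ℤ.- i ⟧ ≡ - ⟦ i ⟧
  ⟦⟧-neg (+ zero)   = sym -0#≈0#
  ⟦⟧-neg (+ suc m)  = refl
  ⟦⟧-neg (-[1+ m ]) = sym (-‿involutive _)

  ⟦⟧-⊖ : ∀ m n → ⟦ m ℤ.⊖ n ⟧ ≡ m · 1# - n · 1#
  ⟦⟧-⊖ m n with ℕ.≤-total n m
  ... | inj₁ n≤m = begin
    ⟦ m ℤ.⊖ n ⟧                                 ≡⟨ cong ⟦_⟧ (ℤ.⊖-≥ n≤m) ⟩
    (m ℕ.∸ n) · 1#                              ≡⟨ +-identityʳ _ ⟨
    (m ℕ.∸ n) · 1# + 0#                         ≡⟨ cong (λ x → (m ℕ.∸ n) · 1# + x) (-‿inverseʳ _) ⟨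
    (m ℕ.∸ n) · 1# + (n · 1# - n · 1#)          ≡⟨ +-assoc _ _ _ ⟨
    ((m ℕ.∸ n) · 1# + n · 1#) - n · 1#          ≡⟨ cong (_- n · 1#) (×-homo-+ 1# (m ℕ.∸ n) n) ⟨
    (m ℕ.∸ n ℕ.+ n) · 1# - n · 1#               ≡⟨ cong (λ x → x · 1# - n · 1#) (ℕ.m∸n+n≡m n≤m) ⟩
    m · 1# - n · 1#                             ∎
  ... | inj₂ m≤n = begin
    ⟦ m ℤ.⊖ n ⟧                                 ≡⟨ cong ⟦_⟧ (ℤ.⊖-≤ m≤n) ⟩
    ⟦ ℤ.- + (n ℕ.∸ m) ⟧                         ≡⟨ ⟦⟧-neg (+ (n ℕ.∸ m)) ⟩
    - ((n ℕ.∸ m) · 1#)                          ≡⟨ +-identityˡ _ ⟨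
    0# - (n ℕ.∸ m) · 1#                         ≡⟨ cong (_- (n ℕ.∸ m) · 1#) (-‿inverseʳ _) ⟨
    (m · 1# - m · 1#) - (n ℕ.∸ m) · 1#          ≡⟨ +-assoc _ _ _ ⟩
    m · 1# + (- (m · 1#) - (n ℕ.∸ m) · 1#)      ≡⟨ cong (λ x → m · 1# + x) (-‿+-comm _ _) ⟩
    m · 1# - (m · 1# + (n ℕ.∸ m) · 1#)          ≡⟨ cong (λ x → m · 1# - x) (×-homo-+ 1# m (n ℕ.∸ m)) ⟨
    m · 1# - (m ℕ.+ (n ℕ.∸ m)) · 1#             ≡⟨ cong (λ x → m · 1# - x · 1#) (ℕ.m+[n∸m]≡n m≤n) ⟩
    m · 1# - n · 1#                             ∎

  ⟦⟧-+ : ∀ i j → ⟦ i ℤ.+ j ⟧ ≡ ⟦ i ⟧ + ⟦ j ⟧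
  ⟦⟧-+ (+ m)    (+ n)    = ×-homo-+ 1# m n
  ⟦⟧-+ (+ m)    -[1+ n ] = ⟦⟧-⊖ m (suc n)
  ⟦⟧-+ -[1+ m ] (+ n)    = trans (⟦⟧-⊖ n (suc m)) (+-comm _ _)
  ⟦⟧-+ -[1+ m ] -[1+ n ] = begin
    - (suc (suc (m ℕ.+ n)) · 1#)      ≡⟨ cong (λ x → - (suc x · 1#)) (ℕ.+-suc m n) ⟨
    - ((suc m ℕ.+ suc n) · 1#)        ≡⟨ cong -_ (×-homo-+ 1# (suc m) (suc n)) ⟩
    - (suc m · 1# + suc n · 1#)       ≡⟨ -‿+-comm _ _ ⟨
    - (suc m · 1#) - suc n · 1#       ∎

  ⟦⟧-*-+ : ∀ i n → ⟦ i ℤ.* + n ⟧ ≡ ⟦ i ⟧ * ⟦ + n ⟧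
  ⟦⟧-*-+ (+ m)    n = trans (cong ⟦_⟧ (sym (ℤ.pos-* m n))) (×1-homo-* m n)
  ⟦⟧-*-+ -[1+ m ] n = begin
    ⟦ -[1+ m ] ℤ.* + n ⟧              ≡⟨ cong ⟦_⟧ (ℤ.neg-distribˡ-* (+ suc m) (+ n)) ⟨
    ⟦ ℤ.- (+ suc m ℤ.* + n) ⟧         ≡⟨ ⟦⟧-neg (+ suc m ℤ.* + n) ⟩
    - ⟦ + suc m ℤ.* + n ⟧             ≡⟨ cong -_ (⟦⟧-*-+ (+ suc m) n) ⟩
    - (⟦ + suc m ⟧ * ⟦ + n ⟧)         ≡⟨ -‿distribˡ-* _ _ ⟩
    ⟦ -[1+ m ] ⟧ * ⟦ + n ⟧            ∎

  ⟦⟧-* : ∀ i j → ⟦ i ℤ.* j ⟧ ≡ ⟦ i ⟧ * ⟦ j ⟧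
  ⟦⟧-* i (+ n)    = ⟦⟧-*-+ i n
  ⟦⟧-* i -[1+ n ] = begin
    ⟦ i ℤ.* -[1+ n ] ⟧                ≡⟨ cong ⟦_⟧ (ℤ.neg-distribʳ-* i (+ suc n)) ⟨
    ⟦ ℤ.- (i ℤ.* + suc n) ⟧           ≡⟨ ⟦⟧-neg (i ℤ.* + suc n) ⟩
    - ⟦ i ℤ.* + suc n ⟧               ≡⟨ cong -_ (⟦⟧-*-+ i (suc n)) ⟩
    - (⟦ i ⟧ * ⟦ + suc n ⟧)           ≡⟨ -‿distribʳ-* _ _ ⟩
    ⟦ i ⟧ * ⟦ -[1+ n ] ⟧              ∎

  ⟦⟧-morphism : ℤ.+-*-rawRing -Raw-AlmostCommutative⟶ fromCommutativeRing commutativeRing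
  ⟦⟧-morphism = record
    { ⟦_⟧ = ⟦_⟧ ; +-homo = ⟦⟧-+ ; *-homo = ⟦⟧-* ; -‿homo = ⟦⟧-neg
    ; 0-homo = refl ; 1-homo = +-identityʳ 1# }

  open Algebra.Solver.Ring ℤ.+-*-rawRing (fromCommutativeRing commutativeRing) ⟦⟧-morphism
    (λ i j → Data.Maybe.map (cong ⟦_⟧) (dec⇒maybe (i ℤ.≟ j))) public
    using (solve; _:=_; _:+_; _:*_; _:-_; :-_; con)

  0<⇒≢0 : ∀ {x} → 0# < x → x ≢ 0#
  0<⇒≢0 0<x x≡0 = <-irrefl (sym x≡0) 0<x

  0<-+ : ∀ {x y} → 0# < x → 0# < y → 0# < x + y
  0<-+ {x} {y} 0<x 0<y = <-trans 0<y (subst (_< x + y) (+-identityˡ y) (+-mono-< 0# x y 0<x))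

  0<-+-0≤ : ∀ {x y} → 0# < x → 0# ≤ y → 0# < x + y
  0<-+-0≤ 0<x (inj₁ 0<y)  = 0<-+ 0<x 0<y
  0<-+-0≤ 0<x (inj₂ refl) = subst (0# <_) (sym (+-identityʳ _)) 0<x

  0≤-+-0< : ∀ {x y} → 0# ≤ x → 0# < y → 0# < x + y
  0≤-+-0< 0≤x 0<y = subst (0# <_) (+-comm _ _) (0<-+-0≤ 0<y 0≤x)

  0≤-+ : ∀ {x y} → 0# ≤ x → 0# ≤ y → 0# ≤ x + y
  0≤-+ (inj₁ 0<x) 0≤y         = inj₁ (0<-+-0≤ 0<x 0≤y)
  0≤-+ (inj₂ refl) (inj₁ 0<y) = inj₁ (0≤-+-0< (inj₂ refl) 0<y)
  0≤-+ (inj₂ refl) (inj₂ refl) = inj₂ (sym (+-identityˡ 0#))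

  0≤-* : ∀ {x y} → 0# ≤ x → 0# ≤ y → 0# ≤ x * y
  0≤-* (inj₁ 0<x) (inj₁ 0<y) = inj₁ (*-pos _ _ 0<x 0<y)
  0≤-* (inj₂ refl) _         = inj₂ (sym (zeroˡ _))
  0≤-* _ (inj₂ refl)         = inj₂ (sym (zeroʳ _))

  <⇒0<- : ∀ {x y} → x < y → 0# < y - x
  <⇒0<- {x} {y} x<y = subst (_< y - x) (-‿inverseʳ x) (+-mono-< x y (- x) x<y)

  0<-⇒< : ∀ {x y} → 0# < y - x → x < y
  0<-⇒< {x} {y} p = subst₂ _<_ (+-identityˡ x)
    (solve 2 (λ x y → (y :- x) :+ x := y) refl x y) (+-mono-< 0# (y - x) x p)

  0≤-⇒≤ : ∀ {x y} → 0# ≤ y - x → x ≤ y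
  0≤-⇒≤ (inj₁ p) = inj₁ (0<-⇒< p)
  0≤-⇒≤ {x} {y} (inj₂ p) = inj₂ (begin
    x            ≡⟨ +-identityˡ x ⟨
    0# + x       ≡⟨ cong (_+ x) p ⟩
    (y - x) + x  ≡⟨ solve 2 (λ x y → (y :- x) :+ x := y) refl x y ⟩
    y            ∎)

  ≤⇒0≤- : ∀ {x y} → x ≤ y → 0# ≤ y - x
  ≤⇒0≤- (inj₁ x<y)      = inj₁ (<⇒0<- x<y)
  ≤⇒0≤- {x} (inj₂ refl) = inj₂ (sym (-‿inverseʳ x))

  <0⇒0<- : ∀ {x} → x < 0# → 0# < - x
  <0⇒0<- x<0 = subst (0# <_) (+-identityˡ _) (<⇒0<- x<0)

  0≤⊎0<- : ∀ x → 0# ≤ x ⊎ 0# < - x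
  0≤⊎0<- x with compare 0# x
  ... | tri< 0<x _ _ = inj₁ (inj₁ 0<x)
  ... | tri≈ _ 0≡x _ = inj₁ (inj₂ 0≡x)
  ... | tri> _ _ x<0 = inj₂ (<0⇒0<- x<0)

  0≤-⇒≮0 : ∀ {x} → 0# ≤ - x → ¬ 0# < x
  0≤-⇒≮0 0≤-x 0<x = 0<⇒≢0 (0<-+-0≤ 0<x 0≤-x) (-‿inverseʳ _)

  ≮0⇒0≤- : ∀ {x} → ¬ 0# < x → 0# ≤ - x
  ≮0⇒0≤- {x} 0≮x with compare 0# x
  ... | tri< 0<x _ _ = contradiction 0<x 0≮x
  ... | tri≈ _ 0≡x _ = inj₂ (trans (sym -0#≈0#) (cong -_ 0≡x))
  ... | tri> _ _ x<0 = inj₁ (<0⇒0<- x<0)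

  0<⇒≰0 : ∀ {x} → 0# < x → ¬ (x ≤ 0#)
  0<⇒≰0 0<x (inj₁ x<0)  = <-irrefl refl (<-trans 0<x x<0)
  0<⇒≰0 0<x (inj₂ refl) = <-irrefl refl 0<x

  0<-inverse : ∀ {x y} → 0# < x → x * y ≡ 1# → 0# < y
  0<-inverse {x} {y} 0<x xy≡1 with 0≤⊎0<- y
  ... | inj₁ (inj₁ 0<y) = 0<y
  ... | inj₁ (inj₂ refl) = contradiction (trans (sym xy≡1) (zeroʳ x)) (0<⇒≢0 0<1)
  ... | inj₂ 0<-y = contradiction
    (solve 2 (λ x y → x :* (:- y) :+ x :* y := con (+ 0)) refl x y)
    (0<⇒≢0 (0<-+ (*-pos _ _ 0<x 0<-y) (subst (0# <_) (sym xy≡1) 0<1)))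

  *-nonzero : ∀ {x y} → x * y ≡ 0# → x ≢ 0# → y ≡ 0#
  *-nonzero {x} {y} xy≡0 x≢0 with i , xi≡1 ← inverse x x≢0 = begin
    y            ≡⟨ *-identityˡ y ⟨
    1# * y       ≡⟨ cong (_* y) xi≡1 ⟨
    x * i * y    ≡⟨ solve 3 (λ x y i → x :* i :* y := x :* y :* i) refl x y i ⟩
    x * y * i    ≡⟨ cong (_* i) xy≡0 ⟩
    0# * i       ≡⟨ zeroˡ i ⟩
    0#           ∎

  pos : Carrier → Parity
  pos x = if does (0# <? x) then 1ℙ else 0ℙ

  pos-yes : ∀ {x} → 0# < x → pos x ≡ 1ℙ
  pos-yes {x} 0<x = cong (if_then 1ℙ else 0ℙ) (dec-true (0# <? x) 0<x)

  pos-no : ∀ {x} → 0# ≤ - x → pos x ≡ 0ℙ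
  pos-no {x} 0≤-x = cong (if_then 1ℙ else 0ℙ) (dec-false (0# <? x) (0≤-⇒≮0 0≤-x))

  pos-view : ∀ x → (0# < x × pos x ≡ 1ℙ) ⊎ (0# ≤ - x × pos x ≡ 0ℙ)
  pos-view x with 0# <? x
  ... | yes 0<x = inj₁ (0<x , refl)
  ... | no  0≮x = inj₂ (≮0⇒0≤- 0≮x , refl)

-- Winding around the origin

module Geometry (ℝ : RealNumbers) where
  open RealNumbers ℝ
  open Plabic ℝ
  open OrderedField ℝ

  cross-antisym : ∀ u v → cross u v ≡ - cross v u
  cross-antisym (u₁ , u₂) (v₁ , v₂) =
    solve 4 (λ u₁ u₂ v₁ v₂ → u₁ :* v₂ :- u₂ :* v₁ := :- (v₁ :* u₂ :- v₂ :* u₁)) refl u₁ u₂ v₁ v₂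

  -cross : ∀ u v → - cross u v ≡ cross v u
  -cross u v = sym (cross-antisym v u)

  -- The three-term Plücker relation. It is used to deduce the sign of one cross product from the
  -- signs of the other five.
  plücker : ∀ a b c z → cross a z * cross b c + (cross b z * cross c a + cross c z * cross a b) ≡ 0#
  plücker (a₁ , a₂) (b₁ , b₂) (c₁ , c₂) (z₁ , z₂) =
    solve 8 (λ a₁ a₂ b₁ b₂ c₁ c₂ z₁ z₂ →
      (a₁ :* z₂ :- a₂ :* z₁) :* (b₁ :* c₂ :- b₂ :* c₁) :+
      ((b₁ :* z₂ :- b₂ :* z₁) :* (c₁ :* a₂ :- c₂ :* a₁) :+
       (c₁ :* z₂ :- c₂ :* z₁) :* (a₁ :* b₂ :- a₂ :* b₁)) := con (+ 0))
      refl a₁ a₂ b₁ b₂ c₁ c₂ z₁ z₂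

  -- The weights need only a positive sum, not the sum 1, so that cross products can serve as
  -- weights without division.
  record OriginInHull (a b c : Point) : Set where
    field
      α β γ : Carrier
      0≤α   : 0# ≤ α
      0≤β   : 0# ≤ β
      0≤γ   : 0# ≤ γ
      0<sum : 0# < α + (β + γ)
      balance₁ : α * proj₁ a + (β * proj₁ b + γ * proj₁ c) ≡ 0#
      balance₂ : α * proj₂ a + (β * proj₂ b + γ * proj₂ c) ≡ 0#

  rotate : ∀ {a b c} → OriginInHull a b c → OriginInHull b c a
  rotate {a} {b} {c} h = record
    { α = β ; β = γ ; γ = α ; 0≤α = 0≤β ; 0≤β = 0≤γ ; 0≤γ = 0≤α
    ; 0<sum = subst (0# <_) (solve 3 (λ α β γ → α :+ (β :+ γ) := β :+ (γ :+ α)) refl α β γ) 0<sum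
    ; balance₁ = trans (cycle (α * proj₁ a) _ _) balance₁
    ; balance₂ = trans (cycle (α * proj₂ a) _ _) balance₂ }
    where
    open OriginInHull h
    cycle : ∀ x y z → y + (z + x) ≡ x + (y + z)
    cycle = solve 3 (λ x y z → y :+ (z :+ x) := x :+ (y :+ z)) refl

  swap : ∀ {a b c} → OriginInHull a b c → OriginInHull a c b
  swap {a} {b} {c} h = record
    { α = α ; β = γ ; γ = β ; 0≤α = 0≤α ; 0≤β = 0≤γ ; 0≤γ = 0≤β
    ; 0<sum = subst (0# <_) (flip α β γ) 0<sum
    ; balance₁ = trans (flip (α * proj₁ a) _ _) balance₁
    ; balance₂ = trans (flip (α * proj₂ a) _ _) balance₂ }
    where
    open OriginInHull h
    flip : ∀ x y z → x + (y + z) ≡ x + (z + y)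
    flip = solve 3 (λ x y z → x :+ (y :+ z) := x :+ (z :+ y)) refl

  -- Cramer's rule: the weights are the unnormalised barycentric coordinates of the origin, twice
  -- the signed areas of the triangles that it spans with the opposite sides.
  crossHull : ∀ a b c → 0# ≤ cross b c → 0# ≤ cross c a → 0# < cross a b → OriginInHull a b c
  crossHull a@(a₁ , a₂) b@(b₁ , b₂) c@(c₁ , c₂) p q r = record
    { α = cross b c ; β = cross c a ; γ = cross a b
    ; 0≤α = p ; 0≤β = q ; 0≤γ = inj₁ r ; 0<sum = 0≤-+-0< p (0≤-+-0< q r)
    ; balance₁ = solve 6 (λ a₁ a₂ b₁ b₂ c₁ c₂ →
        (b₁ :* c₂ :- b₂ :* c₁) :* a₁ :+
        ((c₁ :* a₂ :- c₂ :* a₁) :* b₁ :+ (a₁ :* b₂ :- a₂ :* b₁) :* c₁) := con (+ 0))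
        refl a₁ a₂ b₁ b₂ c₁ c₂
    ; balance₂ = solve 6 (λ a₁ a₂ b₁ b₂ c₁ c₂ →
        (b₁ :* c₂ :- b₂ :* c₁) :* a₂ :+
        ((c₁ :* a₂ :- c₂ :* a₁) :* b₂ :+ (a₁ :* b₂ :- a₂ :* b₁) :* c₂) := con (+ 0))
        refl a₁ a₂ b₁ b₂ c₁ c₂ }

  module Crossing (l : Point) where

    side : Point → Parity
    side d = pos (cross d l)

    crossing : Parity → Parity → Carrier → Carrier → Parity
    crossing 1ℙ 0ℙ x y = pos x
    crossing 0ℙ 1ℙ x y = pos y
    crossing _  _  x y = 0ℙ

    -- For vectors d, d′ whose segment avoids the origin, the parity of the
    -- number of points at which the segment crosses the ray from the origin
    -- in direction l; a point on the line of l counts as lying on its left.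
    χ : Point → Point → Parity
    χ d d′ = crossing (side d) (side d′) (cross d d′) (cross d′ d)

    χ-sym : ∀ d d′ → χ d d′ ≡ χ d′ d
    χ-sym d d′ with side d | side d′
    ... | 0ℙ | 0ℙ = refl
    ... | 0ℙ | 1ℙ = refl
    ... | 1ℙ | 0ℙ = refl
    ... | 1ℙ | 1ℙ = refl

    private
      -- The point `a` lies to the right of the line of `l`, while `b` and `c` do not. The segment
      -- from `a` to `b` crosses this line on the ray and the one from `a` to `c` does not, so the
      -- origin is caught between the two crossings. `hull₀` is the mirror image.
      hull₁ : ∀ a b c → 0# < cross a l → 0# ≤ - cross b l → 0# ≤ - cross c l →
              0# < cross a b → 0# ≤ - cross a c → OriginInHull a b c
      hull₁ a b c a>0 b≤0 c≤0 ab>0 ac≤0 = crossHull a b c bc≥0 (subst (0# ≤_) (-cross a c) ac≤0) ab>0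
        where
        bc≥0 : 0# ≤ cross b c
        bc≥0 with 0≤⊎0<- (cross b c)
        ... | inj₁ p = p
        ... | inj₂ p = contradiction
          (trans (solve 6 (λ x y z u v w →
                   x :* (:- u) :+ ((:- y) :* v :+ (:- z) :* w) :=
                   :- (x :* u :+ (y :* v :+ z :* w))) refl (cross a l) (cross b l) (cross c l)
                     (cross b c) (cross c a) (cross a b))
            (trans (cong -_ (plücker a b c l)) -0#≈0#))
          (0<⇒≢0 (0<-+-0≤ (*-pos _ _ a>0 p)
            (0≤-+ (0≤-* b≤0 (subst (0# ≤_) (-cross a c) ac≤0)) (0≤-* c≤0 (inj₁ ab>0)))))

      hull₀ : ∀ a b c → 0# ≤ - cross a l → 0# < cross b l → 0# < cross c l →
              0# < cross b a → 0# ≤ - cross c a → OriginInHull a b c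
      hull₀ a b c a≤0 b>0 c>0 ba>0 ca≤0 = swap (rotate (crossHull b a c ac≥0 cb≥0 ba>0))
        where
        ac≥0 : 0# ≤ cross a c
        ac≥0 = subst (0# ≤_) (-cross c a) ca≤0
        cb≥0 : 0# ≤ cross c b
        cb≥0 with 0≤⊎0<- (cross c b)
        ... | inj₁ p = p
        ... | inj₂ p = contradiction
          (trans (solve 6 (λ x y z u v w →
                   (:- x) :* (:- u) :+ (y :* v :+ z :* w) :=
                   x :* u :+ (y :* v :+ z :* w)) refl (cross a l) (cross c l) (cross b l)
                     (cross c b) (cross b a) (cross a c))
            (plücker a c b l))
          (0<⇒≢0 (0≤-+-0< (0≤-* a≤0 (inj₁ p))
            (0<-+-0≤ (*-pos _ _ c>0 ba>0) (0≤-* (inj₁ b>0) ac≥0))))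

    χ-10 : ∀ d d′ → side d ≡ 1ℙ → side d′ ≡ 0ℙ → χ d d′ ≡ pos (cross d d′)
    χ-10 d d′ = cong₂ (λ σ τ → crossing σ τ (cross d d′) (cross d′ d))

    χ-01 : ∀ d d′ → side d ≡ 0ℙ → side d′ ≡ 1ℙ → χ d d′ ≡ pos (cross d′ d)
    χ-01 d d′ = cong₂ (λ σ τ → crossing σ τ (cross d d′) (cross d′ d))

    χ-≡ : ∀ d d′ → side d ≡ side d′ → χ d d′ ≡ 0ℙ
    χ-≡ d d′ eq with side d | side d′
    χ-≡ d d′ refl | 0ℙ | 0ℙ = refl
    χ-≡ d d′ refl | 1ℙ | 1ℙ = refl

    -- Both segments from `a` cross the line of `l`. If only one of them crossed on the ray, the
    -- origin would lie between the two crossing points, hence in the triangle.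
    χ-apex : ∀ a b c → ¬ OriginInHull a b c → side b ≡ side c → side a ≢ side b → χ a b ≡ χ a c
    χ-apex a b c avoids b≡c a≢b
      with pos-view (cross a l) | pos-view (cross b l) | pos-view (cross c l)
    ... | inj₁ (_ , a≡1)   | inj₁ (_ , b≡1)   | _ = contradiction (trans a≡1 (sym b≡1)) a≢b
    ... | inj₂ (_ , a≡0)   | inj₂ (_ , b≡0)   | _ = contradiction (trans a≡0 (sym b≡0)) a≢b
    ... | _ | inj₁ (_ , b≡1) | inj₂ (_ , c≡0) = contradiction (trans (sym b≡1) (trans b≡c c≡0)) λ ()
    ... | _ | inj₂ (_ , b≡0) | inj₁ (_ , c≡1) = contradiction (trans (sym b≡0) (trans b≡c c≡1)) λ ()
    ... | inj₁ (a>0 , a≡1) | inj₂ (b≤0 , b≡0) | inj₂ (c≤0 , c≡0)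
      rewrite χ-10 a b a≡1 b≡0 | χ-10 a c a≡1 c≡0
      with pos-view (cross a b) | pos-view (cross a c)
    ...   | inj₁ (_ , p) | inj₁ (_ , q) = trans p (sym q)
    ...   | inj₂ (_ , p) | inj₂ (_ , q) = trans p (sym q)
    ...   | inj₁ (ab>0 , _) | inj₂ (ac≤0 , _) = contradiction (hull₁ a b c a>0 b≤0 c≤0 ab>0 ac≤0) avoids
    ...   | inj₂ (ab≤0 , _) | inj₁ (ac>0 , _) = contradiction (swap (hull₁ a c b a>0 c≤0 b≤0 ac>0 ab≤0)) avoids
    χ-apex a b c avoids b≡c a≢b | inj₂ (a≤0 , a≡0) | inj₁ (b>0 , b≡1) | inj₁ (c>0 , c≡1)
      rewrite χ-01 a b a≡0 b≡1 | χ-01 a c a≡0 c≡1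
      with pos-view (cross b a) | pos-view (cross c a)
    ...   | inj₁ (_ , p) | inj₁ (_ , q) = trans p (sym q)
    ...   | inj₂ (_ , p) | inj₂ (_ , q) = trans p (sym q)
    ...   | inj₁ (ba>0 , _) | inj₂ (ca≤0 , _) = contradiction (hull₀ a b c a≤0 b>0 c>0 ba>0 ca≤0) avoids
    ...   | inj₂ (ba≤0 , _) | inj₁ (ca>0 , _) = contradiction (swap (hull₀ a c b a≤0 c>0 b>0 ca>0 ba≤0)) avoids

    -- Unless all three points are on one side, exactly one is alone on its side. The two segments
    -- at that point have equal `χ` by `χ-apex`, and the third segment contributes zero.
    χ-triangle : ∀ a b c → ¬ OriginInHull a b c → χ a b ℙ.+ χ b c ≡ χ a c
    χ-triangle a b c avoids with side a ℙ.≟ side b | side b ℙ.≟ side c | side a ℙ.≟ side c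
    ... | yes a≡b | yes b≡c | _
      rewrite χ-≡ a b a≡b | χ-≡ b c b≡c | χ-≡ a c (trans a≡b b≡c) = refl
    ... | yes a≡b | no b≢c | _
      rewrite χ-≡ a b a≡b | χ-sym b c | χ-sym a c
      = χ-apex c b a (avoids ∘ rotate ∘ swap) (sym a≡b) (b≢c ∘ sym)
    ... | no a≢b | yes b≡c | _
      rewrite χ-≡ b c b≡c = trans (ℙ.+-identityʳ _) (χ-apex a b c avoids b≡c a≢b)
    ... | no a≢b | no b≢c | yes a≡c
      rewrite χ-≡ a c a≡c | χ-sym a b
      = trans (cong (ℙ._+ χ b c) (χ-apex b a c (avoids ∘ swap ∘ rotate) a≡c (a≢b ∘ sym)))
              (ℙ.p+p≡0ℙ (χ b c))
    ... | no a≢b | no b≢c | no a≢c = contradiction (two (side a) (side b) (side c) a≢b b≢c) a≢c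
      where
      two : ∀ p q r → p ≢ q → q ≢ r → p ≡ r
      two 0ℙ 0ℙ _  p≢q _ = contradiction refl p≢q
      two 1ℙ 1ℙ _  p≢q _ = contradiction refl p≢q
      two _  0ℙ 0ℙ _ q≢r = contradiction refl q≢r
      two _  1ℙ 1ℙ _ q≢r = contradiction refl q≢r
      two 0ℙ 1ℙ 0ℙ _ _ = refl
      two 1ℙ 0ℙ 1ℙ _ _ = refl

    module HalfPlane (axis : Point) (l>0 : 0# < cross l axis) where

      private
        -- The Plücker relation for `l`, `axis`, `d`, `d′`. Since `cross l axis` is positive, it
        -- reads off the sign of `cross d d′` from the heights over the line of `axis` and the sides
        -- with respect to `l`.
        weighted : ∀ d d′ → cross l axis * cross d d′ ≡
                   cross d axis * (- cross d′ l) + cross d′ axis * cross d l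
        weighted (a₁ , a₂) (b₁ , b₂) =
          solve 8 (λ l₁ l₂ a₁ a₂ b₁ b₂ z₁ z₂ →
            (l₁ :* z₂ :- l₂ :* z₁) :* (a₁ :* b₂ :- a₂ :* b₁) :=
            (a₁ :* z₂ :- a₂ :* z₁) :* (:- (b₁ :* l₂ :- b₂ :* l₁)) :+
            (b₁ :* z₂ :- b₂ :* z₁) :* (a₁ :* l₂ :- a₂ :* l₁))
            refl (proj₁ l) (proj₂ l) a₁ a₂ b₁ b₂ (proj₁ axis) (proj₂ axis)

        opposite : ∀ d d′ → cross l axis * cross d d′ + cross l axis * cross d′ d ≡ 0#
        opposite (a₁ , a₂) (b₁ , b₂) =
          solve 5 (λ n a₁ a₂ b₁ b₂ →
            n :* (a₁ :* b₂ :- a₂ :* b₁) :+ n :* (b₁ :* a₂ :- b₂ :* a₁) := con (+ 0))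
            refl (cross l axis) a₁ a₂ b₁ b₂

      weighted-pos : ∀ d d′ → 0# < cross l axis * cross d d′ → 0# < cross d d′
      weighted-pos d d′ p with 0≤⊎0<- (cross d d′)
      ... | inj₁ (inj₁ q) = q
      ... | inj₁ (inj₂ q) = contradiction
        (trans (cong (cross l axis *_) (sym q)) (solve 1 (λ x → x :* con (+ 0) := con (+ 0)) refl _))
        (0<⇒≢0 p)
      ... | inj₂ q = contradiction (opposite d d′)
        (0<⇒≢0 (0<-+ p (*-pos _ _ l>0 (subst (0# <_) (-cross d d′) q))))

      weighted-nonpos : ∀ d d′ → 0# ≤ - (cross l axis * cross d d′) → 0# ≤ - cross d d′
      weighted-nonpos d d′ p = ≮0⇒0≤- λ q → 0≤-⇒≮0 p (*-pos _ _ l>0 q)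

      -- The segment stays in the half-plane into which `l` points, so it can meet the line of `l`
      -- only on the ray itself, and `χ` just compares sides. The weak alternative for `d′` covers
      -- the end of a path on the boundary; being off the line of `l` keeps `d′` from being zero.
      χ-upper : ∀ d d′ → 0# < cross d axis →
                0# < cross d′ axis ⊎ (cross d′ axis ≡ 0# × cross d′ l ≢ 0#) →
                χ d d′ ≡ side d ℙ.+ side d′
      χ-upper d d′ d>0 d′≥0 with pos-view (cross d l) | pos-view (cross d′ l)
      ... | inj₁ (_ , p) | inj₁ (_ , q) rewrite χ-≡ d d′ (trans p (sym q)) | p | q = refl
      ... | inj₂ (_ , p) | inj₂ (_ , q) rewrite χ-≡ d d′ (trans p (sym q)) | p | q = refl
      ... | inj₂ (dl≤0 , p) | inj₁ (d′l>0 , q) rewrite χ-01 d d′ p q | p | q =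
        pos-yes (weighted-pos d′ d (subst (0# <_) (sym (weighted d′ d))
          (0≤-+-0< (0≤-* d′-axis dl≤0) (*-pos _ _ d>0 d′l>0))))
        where
        d′-axis : 0# ≤ cross d′ axis
        d′-axis = map₂ (sym ∘ proj₁) d′≥0
      ... | inj₁ (dl>0 , p) | inj₂ (d′l≤0 , q) rewrite χ-10 d d′ p q | p | q =
        pos-yes (weighted-pos d d′ (subst (0# <_) (sym (weighted d d′)) (positive d′≥0 d′l≤0)))
        where
        positive : 0# < cross d′ axis ⊎ (cross d′ axis ≡ 0# × cross d′ l ≢ 0#) → 0# ≤ - cross d′ l →
                   0# < cross d axis * (- cross d′ l) + cross d′ axis * cross d l
        positive (inj₁ x) y = 0≤-+-0< (0≤-* (inj₁ d>0) y) (*-pos _ _ x dl>0)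
        positive (inj₂ (x , _)) (inj₁ y) =
          0<-+-0≤ (*-pos _ _ d>0 y) (0≤-* (inj₂ (sym x)) (inj₁ dl>0))
        positive (inj₂ (_ , d′l≢0)) (inj₂ y) = contradiction
          (trans (solve 1 (λ x → x := :- (:- x)) refl _)
                 (trans (cong -_ (sym y)) -0#≈0#)) d′l≢0

      private
        nonpositive : ∀ d d′ → 0# ≤ - cross d axis → 0# ≤ - cross d′ axis → 0# ≤ cross d l →
                      0# ≤ - cross d′ l → 0# ≤ - cross d d′
        nonpositive d d′ d≤0 d′≤0 dl≥0 d′l≤0 = weighted-nonpos d d′ (subst (0# ≤_)
          (sym (trans (cong -_ (weighted d d′))
            (solve 4 (λ x y z w → :- (x :* (:- y) :+ z :* w) := (:- x) :* (:- y) :+ (:- z) :* w)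
              refl (cross d axis) (cross d′ l) (cross d′ axis) (cross d l))))
          (0≤-+ (0≤-* d≤0 d′l≤0) (0≤-* d′≤0 dl≥0)))

      -- In the half-plane opposite to `l` the line of `l` can be met only at the origin or on the
      -- opposite ray, and neither is counted.
      χ-lower : ∀ d d′ → 0# ≤ - cross d axis → 0# ≤ - cross d′ axis → χ d d′ ≡ 0ℙ
      χ-lower d d′ d≤0 d′≤0 with pos-view (cross d l) | pos-view (cross d′ l)
      ... | inj₁ (_ , p) | inj₁ (_ , q) = χ-≡ d d′ (trans p (sym q))
      ... | inj₂ (_ , p) | inj₂ (_ , q) = χ-≡ d d′ (trans p (sym q))
      ... | inj₁ (dl>0 , p) | inj₂ (d′l≤0 , q) =
        trans (χ-10 d d′ p q) (pos-no (nonpositive d d′ d≤0 d′≤0 (inj₁ dl>0) d′l≤0))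
      ... | inj₂ (dl≤0 , p) | inj₁ (d′l>0 , q) =
        trans (χ-01 d d′ p q) (pos-no (nonpositive d′ d d′≤0 d≤0 (inj₁ d′l>0) dl≤0))

-- Secants between two segments, and segments meeting a ray

module Segments (ℝ : RealNumbers) where
  open RealNumbers ℝ
  open Plabic ℝ
  open OrderedField ℝ
  open Geometry ℝ
  open ≡-Reasoning
  open CommutativeRing commutativeRing using (zeroʳ; *-identityˡ; +-identityʳ)

  private
    share : ∀ a b c x x′ y y′ → a + (b + c) ≡ 1# → a * (y - x) + (b * (y′ - x) + c * (y′ - x′)) ≡ 0# →
            x + c * (x′ - x) ≡ y + (b + c) * (y′ - y)
    share a b c x x′ y y′ sum balance = begin
      x + c * (x′ - x)
        ≡⟨ cong (λ d → x + c * d) (solve 3 (λ x x′ y′ → x′ :- x := (y′ :- x) :- (y′ :- x′)) refl x x′ y′) ⟩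
      x + c * (q - r)
        ≡⟨ +-identityʳ _ ⟨
      x + c * (q - r) + 0#
        ≡⟨ cong (λ z → x + c * (q - r) + z) balance ⟨
      x + c * (q - r) + (a * p + (b * q + c * r))
        ≡⟨ solve 7 (λ a b c x p q r → x :+ c :* (q :- r) :+ (a :* p :+ (b :* q :+ c :* r)) :=
             x :+ (a :+ (b :+ c)) :* p :+ (b :+ c) :* (q :- p)) refl a b c x p q r ⟩
      x + (a + (b + c)) * p + (b + c) * (q - p)
        ≡⟨ cong (λ z → x + z * p + (b + c) * (q - p)) sum ⟩
      x + 1# * p + (b + c) * (q - p)
        ≡⟨ cong₂ (λ z w → x + z + (b + c) * w) (*-identityˡ p)
             (solve 3 (λ x y y′ → (y′ :- x) :- (y :- x) := y′ :- y) refl x y y′) ⟩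
      x + p + (b + c) * (y′ - y)
        ≡⟨ cong (_+ (b + c) * (y′ - y)) (solve 2 (λ x y → x :+ (y :- x) := y) refl x y) ⟩
      y + (b + c) * (y′ - y) ∎
      where
      p = y - x
      q = y′ - x
      r = y′ - x′

  -- With weights a, b, c normalised to sum 1, the balance says (a + b) x₀ + c x₁ = a y₀ + (b + c)
  -- y₁, whence the parameters c and b + c. The three vectors are the secants at the corners (0,0),
  -- (0,1), (1,1) of the parameter square, and `t ≤ u` records that the meeting happens in this half
  -- of it.
  hull⇒meet : ∀ x₀ x₁ y₀ y₁ → OriginInHull (y₀ ⊖ x₀) (y₁ ⊖ x₀) (y₁ ⊖ x₁) →
              ∃[ t ] ∃[ u ] 0# ≤ t × t ≤ u × u ≤ 1# × x₀ ⊕ t ⊛ (x₁ ⊖ x₀) ≡ y₀ ⊕ u ⊛ (y₁ ⊖ y₀)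
  hull⇒meet x₀ x₁ y₀ y₁ hull =
    c , b + c , 0≤-* 0≤γ 0≤i ,
    0≤-⇒≤ (subst (0# ≤_) (solve 2 (λ b c → b := (b :+ c) :- c) refl b c) (0≤-* 0≤β 0≤i)) ,
    0≤-⇒≤ (subst (0# ≤_) α-share (0≤-* 0≤α 0≤i)) ,
    cong₂ _,_ (share a b c _ _ _ _ sum≡1 (scale _ _ _ balance₁))
              (share a b c _ _ _ _ sum≡1 (scale _ _ _ balance₂))
    where
    open OriginInHull hull
    inv = inverse (α + (β + γ)) (0<⇒≢0 0<sum)
    i = proj₁ inv
    a = α * i
    b = β * i
    c = γ * i
    0≤i : 0# ≤ i
    0≤i = inj₁ (0<-inverse 0<sum (proj₂ inv))

    sum≡1 : a + (b + c) ≡ 1#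
    sum≡1 = trans (solve 4 (λ α β γ i → α :* i :+ (β :* i :+ γ :* i) := (α :+ (β :+ γ)) :* i) refl α β γ i)
                  (proj₂ inv)

    α-share : a ≡ 1# - (b + c)
    α-share = trans (solve 2 (λ a d → a := (a :+ d) :- d) refl a (b + c)) (cong (_- (b + c)) sum≡1)

    scale : ∀ p q r → α * p + (β * q + γ * r) ≡ 0# → a * p + (b * q + c * r) ≡ 0#
    scale p q r balance = begin
      a * p + (b * q + c * r)                 ≡⟨ solve 7 (λ α β γ i p q r →
                                                   α :* i :* p :+ (β :* i :* q :+ γ :* i :* r) :=
                                                   i :* (α :* p :+ (β :* q :+ γ :* r))) refl α β γ i p q r ⟩
      i * (α * p + (β * q + γ * r))           ≡⟨ cong (i *_) balance ⟩
      i * 0#                                  ≡⟨ zeroʳ i ⟩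
      0#                                      ∎

  Meet : Point → Point → Point → Point → Set
  Meet p q x y = ∃[ z ] OnSegment p q z × OnSegment x y z

  private
    ≤-trans : ∀ {x y z} → x ≤ y → y ≤ z → x ≤ z
    ≤-trans {x} {y} {z} x≤y y≤z = 0≤-⇒≤ (subst (0# ≤_)
      (solve 3 (λ x y z → (y :- x) :+ (z :- y) := z :- x) refl x y z) (0≤-+ (≤⇒0≤- x≤y) (≤⇒0≤- y≤z)))

  hull⇒Meet : ∀ x₀ x₁ y₀ y₁ → OriginInHull (y₀ ⊖ x₀) (y₁ ⊖ x₀) (y₁ ⊖ x₁) → Meet x₀ x₁ y₀ y₁
  hull⇒Meet x₀ x₁ y₀ y₁ hull = meeting (hull⇒meet x₀ x₁ y₀ y₁ hull)
    where
    meeting : ∃[ t ] ∃[ u ] 0# ≤ t × t ≤ u × u ≤ 1# × x₀ ⊕ t ⊛ (x₁ ⊖ x₀) ≡ y₀ ⊕ u ⊛ (y₁ ⊖ y₀) →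
              Meet x₀ x₁ y₀ y₁
    meeting (t , u , 0≤t , t≤u , u≤1 , eq) =
      x₀ ⊕ t ⊛ (x₁ ⊖ x₀) , (t , 0≤t , ≤-trans t≤u u≤1 , refl) , (u , ≤-trans 0≤t t≤u , u≤1 , eq)

  -- Exchanging the two segments brings the other half of the parameter square, with corners (0,0),
  -- (1,0), (1,1), into the form that `hull⇒meet` accepts.
  negate : ∀ x₀ x₁ y₀ y₁ → OriginInHull (y₀ ⊖ x₀) (y₀ ⊖ x₁) (y₁ ⊖ x₁) →
           OriginInHull (x₀ ⊖ y₀) (x₁ ⊖ y₀) (x₁ ⊖ y₁)
  negate x₀ x₁ y₀ y₁ hull = record
    { α = α ; β = β ; γ = γ ; 0≤α = 0≤α ; 0≤β = 0≤β ; 0≤γ = 0≤γ ; 0<sum = 0<sum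
    ; balance₁ = flip (proj₁ x₀) (proj₁ x₁) (proj₁ y₀) (proj₁ y₁) balance₁
    ; balance₂ = flip (proj₂ x₀) (proj₂ x₁) (proj₂ y₀) (proj₂ y₁) balance₂ }
    where
    open OriginInHull hull
    flip : ∀ x x′ y y′ → α * (y - x) + (β * (y - x′) + γ * (y′ - x′)) ≡ 0# →
           α * (x - y) + (β * (x′ - y) + γ * (x′ - y′)) ≡ 0#
    flip x x′ y y′ eq = begin
      α * (x - y) + (β * (x′ - y) + γ * (x′ - y′))
        ≡⟨ cong₂ _+_ (cong (α *_) (anti y x)) (cong₂ _+_ (cong (β *_) (anti y x′)) (cong (γ *_) (anti y′ x′))) ⟩
      α * - p + (β * - q + γ * - r)
        ≡⟨ solve 6 (λ α β γ p q r → α :* (:- p) :+ (β :* (:- q) :+ γ :* (:- r)) :=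
                                     :- (α :* p :+ (β :* q :+ γ :* r))) refl α β γ p q r ⟩
      - (α * p + (β * q + γ * r))                        ≡⟨ cong -_ eq ⟩
      - 0#                                               ≡⟨ -0#≈0# ⟩
      0#                                                 ∎
      where
      p = y - x
      q = y - x′
      r = y′ - x′
      anti : ∀ y x → x - y ≡ - (y - x)
      anti = solve 2 (λ y x → x :- y := :- (y :- x)) refl

  private
    0≤-antisym : ∀ {x} → 0# ≤ x → x ≤ 0# → x ≡ 0#
    0≤-antisym (inj₁ 0<x) x≤0 = contradiction x≤0 (0<⇒≰0 0<x)
    0≤-antisym (inj₂ refl) _  = refl

    shift≡0 : ∀ u x y → x + u * (y - x) ≡ x → u ≢ 0# → x ≡ y
    shift≡0 u x y eq u≢0 = begin
      x             ≡⟨ solve 2 (λ x y → x := y :- (y :- x)) refl x y ⟩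
      y - (y - x)   ≡⟨ cong (λ z → y - z) (*-nonzero stay u≢0) ⟩
      y - 0#        ≡⟨ solve 1 (λ y → y :- con (+ 0) := y) refl y ⟩
      y             ∎
      where
      stay : u * (y - x) ≡ 0#
      stay = begin
        u * (y - x)           ≡⟨ solve 2 (λ x k → k := (x :+ k) :- x) refl x _ ⟩
        x + u * (y - x) - x   ≡⟨ cong (_- x) eq ⟩
        x - x                 ≡⟨ solve 1 (λ x → x :- x := con (+ 0)) refl x ⟩
        0#                    ∎

    ⊛-zero : ∀ x y → x ⊕ 0# ⊛ y ≡ x
    ⊛-zero x y = cong₂ _,_ (eq (proj₁ x) (proj₁ y)) (eq (proj₂ x) (proj₂ y))
      where
      eq : ∀ x y → x + 0# * y ≡ x
      eq = solve 2 (λ x y → x :+ con (+ 0) :* y := x) refl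

  -- The secant between the two segments vanishes only at the shared point `y`, that is at t = 1 and
  -- u = 0, which contradicts `t ≤ u`.
  corner-avoids : ∀ x y z → x ≢ y → y ≢ z → (∀ v → OnSegment x y v → OnSegment y z v → v ≡ y) →
                  ¬ OriginInHull (y ⊖ x) (z ⊖ x) (z ⊖ y)
  corner-avoids x y z x≢y y≢z only hull = impossible (hull⇒meet x y y z hull)
    where
    impossible : ¬ (∃[ t ] ∃[ u ] 0# ≤ t × t ≤ u × u ≤ 1# × x ⊕ t ⊛ (y ⊖ x) ≡ y ⊕ u ⊛ (z ⊖ y))
    impossible (t , u , 0≤t , t≤u , u≤1 , eq) = x≢y (begin
      x                   ≡⟨ ⊛-zero x (y ⊖ x) ⟨
      x ⊕ 0# ⊛ (y ⊖ x)    ≡⟨ cong (λ t → x ⊕ t ⊛ (y ⊖ x)) t≡0 ⟨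
      x ⊕ t ⊛ (y ⊖ x)     ≡⟨ is-y ⟩
      y                   ∎)
      where
      is-y : x ⊕ t ⊛ (y ⊖ x) ≡ y
      is-y = only _ (t , 0≤t , ≤-trans t≤u u≤1 , refl) (u , ≤-trans 0≤t t≤u , u≤1 , eq)

      fixed : y ⊕ u ⊛ (z ⊖ y) ≡ y
      fixed = trans (sym eq) is-y

      u≡0 : u ≡ 0#
      u≡0 with u ≟ 0#
      ... | yes p = p
      ... | no u≢0 = contradiction
        (cong₂ _,_ (shift≡0 u _ _ (cong proj₁ fixed) u≢0) (shift≡0 u _ _ (cong proj₂ fixed) u≢0)) y≢z

      t≡0 : t ≡ 0#
      t≡0 = 0≤-antisym 0≤t (subst (t ≤_) u≡0 t≤u)

  module Lines (l : Point) where
    open Crossing l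

    -- Both ways around the parameter square equal `χ` of its diagonal, by `χ-triangle` on the two
    -- halves.
    χ-cell : ∀ x₀ x₁ y₀ y₁ → ¬ Meet x₀ x₁ y₀ y₁ →
             χ (y₀ ⊖ x₀) (y₁ ⊖ x₀) ℙ.+ χ (y₁ ⊖ x₀) (y₁ ⊖ x₁) ≡
             χ (y₀ ⊖ x₀) (y₀ ⊖ x₁) ℙ.+ χ (y₀ ⊖ x₁) (y₁ ⊖ x₁)
    χ-cell x₀ x₁ y₀ y₁ apart = trans
      (χ-triangle _ _ _ (apart ∘ hull⇒Meet x₀ x₁ y₀ y₁))
      (sym (χ-triangle _ _ _ λ hull → let (z , p , q) = hull⇒Meet y₀ y₁ x₀ x₁ (negate x₀ x₁ y₀ y₁ hull)
                                      in apart (z , q , p)))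

    data Sign (u v : Point) : Set where
      left     : 0# < cross u v → s u v ≡ + 1 → Sign u v
      straight : cross u v ≡ 0# → s u v ≡ + 0 → Sign u v
      right    : 0# < cross v u → s u v ≡ ℤ.- (+ 1) → Sign u v

    sign-view : ∀ u v → Sign u v
    sign-view u v with compare 0# (cross u v) in eq
    ... | tri< p _ _ = left p (s-eq eq)
      where
      s-eq : ∀ {a b c} → compare 0# (cross u v) ≡ tri< a b c → s u v ≡ + 1
      s-eq e rewrite e = refl
    ... | tri≈ _ p _ = straight (sym p) (s-eq eq)
      where
      s-eq : ∀ {a b c} → compare 0# (cross u v) ≡ tri≈ a b c → s u v ≡ + 0
      s-eq e rewrite e = refl
    ... | tri> _ _ p = right (subst (0# <_) (-cross u v) (<0⇒0<- p)) (s-eq eq)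
      where
      s-eq : ∀ {a b c} → compare 0# (cross u v) ≡ tri> a b c → s u v ≡ ℤ.- (+ 1)
      s-eq e rewrite e = refl

    -- `windₗ` as a function of its three signs, so that it computes once they are known.
    agree : ℤ → ℤ → ℤ → ℤ
    agree x y z = if does ((x ℤ.≟ y) ×-dec (x ℤ.≟ z)) then x else + 0

    agree-eq : ∀ {e f x y z} → s e f ≡ x → s e l ≡ y → s l f ≡ z → windₗ l e f ≡ agree x y z
    agree-eq refl refl refl = refl

    private
      negative-side : ∀ u v → 0# < cross v u → pos (cross u v) ≡ 0ℙ
      negative-side u v p = pos-no (subst (0# ≤_) (sym (-cross u v)) (inj₁ p))

    -- If `e` and `f` lie on the same side of the line of `l`, then `s e l` and `s l f` are opposite
    -- and both counts vanish. Otherwise the turn from `e` to `f` passes through `l` or through its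
    -- opposite, and the sign of `cross e f` decides which; a reversal of direction counts as zero
    -- on both sides.
    windₗ-χ : ∀ e f → cross e l ≢ 0# → cross f l ≢ 0# → parityℤ (windₗ l e f) ≡ χ e f
    windₗ-χ e f e∦l f∦l with sign-view e l | sign-view l f
    ... | straight p _ | _ = contradiction p e∦l
    ... | _ | straight p _ = contradiction (trans (cross-antisym f l) (trans (cong -_ p)
            -0#≈0#)) f∦l
    ... | left p eq₁ | right q eq₂ = trans (disagree (sign-view e f))
            (sym (χ-≡ e f (trans (pos-yes p) (sym (pos-yes q)))))
      where
      disagree : Sign e f → parityℤ (windₗ l e f) ≡ 0ℙ
      disagree (left _ eq)     rewrite agree-eq eq eq₁ eq₂ = refl
      disagree (straight _ eq) rewrite agree-eq eq eq₁ eq₂ = refl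
      disagree (right _ eq)    rewrite agree-eq eq eq₁ eq₂ = refl
    ... | right p eq₁ | left q eq₂ = trans (disagree (sign-view e f))
            (sym (χ-≡ e f (trans (negative-side e l p) (sym (negative-side f l q)))))
      where
      disagree : Sign e f → parityℤ (windₗ l e f) ≡ 0ℙ
      disagree (left _ eq)     rewrite agree-eq eq eq₁ eq₂ = refl
      disagree (straight _ eq) rewrite agree-eq eq eq₁ eq₂ = refl
      disagree (right _ eq)    rewrite agree-eq eq eq₁ eq₂ = refl
    ... | left p eq₁ | left q eq₂ rewrite χ-10 e f (pos-yes p) (negative-side f l q) = turning (sign-view e f)
      where
      turning : Sign e f → parityℤ (windₗ l e f) ≡ pos (cross e f)
      turning (left r eq)     rewrite agree-eq eq eq₁ eq₂ = sym (pos-yes r)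
      turning (straight r eq) rewrite agree-eq eq eq₁ eq₂ =
        sym (pos-no (inj₂ (sym (trans (cong -_ r) -0#≈0#))))
      turning (right r eq)    rewrite agree-eq eq eq₁ eq₂ = sym (negative-side e f r)
    ... | right p eq₁ | right q eq₂ rewrite χ-01 e f (negative-side e l p) (pos-yes q) = turning (sign-view e f)
      where
      turning : Sign e f → parityℤ (windₗ l e f) ≡ pos (cross f e)
      turning (left r eq)     rewrite agree-eq eq eq₁ eq₂ = sym (negative-side f e r)
      turning (straight r eq) rewrite agree-eq eq eq₁ eq₂ =
        sym (pos-no (inj₂ (sym (trans (-cross f e) r))))
      turning (right r eq)    rewrite agree-eq eq eq₁ eq₂ = sym (pos-yes r)

    -- As `p` is strictly above the boundary line and `q` not below it, every point of the segment
    -- other than `q` is strictly above. A crossing of the line of `l` through `b` is then at a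
    -- positive parameter, so it lies on the ray.
    module Rays (axis : Point) (l>0 : 0# < cross l axis) (b p q : Point)
      (p>0 : 0# < cross (p ⊖ b) axis) (q≥0 : 0# ≤ cross (q ⊖ b) axis)
      (p∦l : cross (p ⊖ b) l ≢ 0#) (q∦l : cross (q ⊖ b) l ≢ 0#) where

      private
        inv : ∃[ j ] cross l axis * j ≡ 1#
        inv = inverse (cross l axis) (0<⇒≢0 l>0)
        module X = Intersection l axis (proj₁ inv) (proj₂ inv) b p q

        blend : ∀ z u → cross (p ⊖ b) z + u * cross (q ⊖ p) z ≡
                (1# - u) * cross (p ⊖ b) z + u * cross (q ⊖ b) z
        blend (z₁ , z₂) u = begin
          cross (p ⊖ b) z + u * cross (q ⊖ p) z
            ≡⟨ cong (_+ u * cross (q ⊖ p) z) (*-identityˡ _) ⟨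
          1# * cross (p ⊖ b) z + u * cross (q ⊖ p) z
            ≡⟨ cong (λ x → 1# * cross (p ⊖ b) z + u * x) (split (proj₁ b) (proj₂ b) (proj₁ p) (proj₂ p) (proj₁ q) (proj₂ q)) ⟩
          1# * cross (p ⊖ b) z + u * (cross (q ⊖ b) z - cross (p ⊖ b) z)
            ≡⟨ solve 4 (λ e u x y → e :* x :+ u :* (y :- x) := (e :- u) :* x :+ u :* y) refl
                 1# u (cross (p ⊖ b) z) (cross (q ⊖ b) z) ⟩
          (1# - u) * cross (p ⊖ b) z + u * cross (q ⊖ b) z ∎
          where
          z = z₁ , z₂
          split : ∀ b₁ b₂ p₁ p₂ q₁ q₂ → (q₁ - p₁) * z₂ - (q₂ - p₂) * z₁ ≡
                  ((q₁ - b₁) * z₂ - (q₂ - b₂) * z₁) - ((p₁ - b₁) * z₂ - (p₂ - b₂) * z₁)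
          split b₁ b₂ p₁ p₂ q₁ q₂ = solve 8 (λ b₁ b₂ p₁ p₂ q₁ q₂ z₁ z₂ →
                 (q₁ :- p₁) :* z₂ :- (q₂ :- p₂) :* z₁ :=
                 ((q₁ :- b₁) :* z₂ :- (q₂ :- b₂) :* z₁) :- ((p₁ :- b₁) :* z₂ :- (p₂ :- b₂) :* z₁))
                 refl b₁ b₂ p₁ p₂ q₁ q₂ z₁ z₂

        convex-pos : ∀ {x y u} → 0# < x → 0# < y → 0# ≤ u → u ≤ 1# → 0# < (1# - u) * x + u * y
        convex-pos 0<x 0<y (inj₁ 0<u) u≤1 = 0≤-+-0< (0≤-* (≤⇒0≤- u≤1) (inj₁ 0<x)) (*-pos _ _ 0<u 0<y)
        convex-pos {x} {y} 0<x 0<y (inj₂ refl) u≤1 =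
          subst (0# <_) (trans (sym (*-identityˡ x))
            (solve 3 (λ e x y → e :* x := (e :- con (+ 0)) :* x :+ con (+ 0) :* y) refl 1# x y)) 0<x

        balance-point : ∀ {x y} → 0# < x → 0# < y →
                        ∃[ u ] 0# < u × u < 1# × (1# - u) * x - u * y ≡ 0#
        -- The witness is x / (x + y), the zero of the interpolation from x to - y.
        balance-point {x} {y} 0<x 0<y = x * i , *-pos _ _ 0<x 0<i ,
          0<-⇒< (subst (0# <_) rest (*-pos _ _ 0<y 0<i)) , (begin
            (1# - x * i) * x - (x * i) * y   ≡⟨ cong (λ z → z * x - (x * i) * y) rest ⟨
            (y * i) * x - (x * i) * y        ≡⟨ solve 3 (λ x y i → (y :* i) :* x :- (x :* i) :* y := con (+ 0)) refl x y i ⟩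
            0#                               ∎)
          where
          0<x+y = 0<-+ 0<x 0<y
          i = proj₁ (inverse (x + y) (0<⇒≢0 0<x+y))
          xyi = proj₂ (inverse (x + y) (0<⇒≢0 0<x+y))
          0<i = 0<-inverse 0<x+y xyi
          rest : y * i ≡ 1# - x * i
          rest = trans (solve 3 (λ x y i → y :* i := (x :+ y) :* i :- x :* i) refl x y i)
                        (cong (_- x * i) xyi)

        strict : ∀ {x} → x ≢ 0# → 0# ≤ - x → 0# < - x
        strict _ (inj₁ 0<-x) = 0<-x
        strict {x} x≢0 (inj₂ 0≡-x) = contradiction (trans (solve 1 (λ x → x := :- (:- x)) refl x)
          (trans (cong -_ (sym 0≡-x)) -0#≈0#)) x≢0

        crosses-at : ∀ u → 0# < u → u < 1# → (1# - u) * cross (p ⊖ b) l + u * cross (q ⊖ b) l ≡ 0# →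
                     Crosses b l p q
        crosses-at u 0<u u<1 root =
          _ , u , t>0 , inj₁ 0<u , inj₁ u<1 , X.meet u (trans (blend l u) root)
          where
          j>0 = 0<-inverse l>0 (proj₂ inv)
          t>0 : 0# < cross (p ⊖ b) axis * proj₁ inv + u * (cross (q ⊖ p) axis * proj₁ inv)
          t>0 = subst (0# <_) (trans (cong (_* proj₁ inv) (sym (blend axis u)))
                  (solve 4 (λ x y u j → (x :+ u :* y) :* j := x :* j :+ u :* (y :* j)) refl
                    (cross (p ⊖ b) axis) (cross (q ⊖ p) axis) u (proj₁ inv)))
                  (*-pos _ _ (0<-+-0≤ (*-pos _ _ (<⇒0<- u<1) p>0) (0≤-* (inj₁ 0<u) q≥0)) j>0)

        cross-at : ∀ {x y} → ∃[ u ] 0# < u × u < 1# × (1# - u) * x - u * y ≡ 0# →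
                   (∀ u → (1# - u) * x - u * y ≡ 0# →
                    (1# - u) * cross (p ⊖ b) l + u * cross (q ⊖ b) l ≡ 0#) → Crosses b l p q
        cross-at (u , 0<u , u<1 , eq) root = crosses-at u 0<u u<1 (root u eq)

      crosses⇒side≢ : Crosses b l p q → side (p ⊖ b) ≢ side (q ⊖ b)
      crosses⇒side≢ (t , u , 0<t , 0≤u , u≤1 , eq) same
        with pos-view (cross (p ⊖ b) l) | pos-view (cross (q ⊖ b) l)
      ... | inj₁ (_ , x) | inj₂ (_ , y) = contradiction (trans (sym x) (trans same y)) λ ()
      ... | inj₂ (_ , x) | inj₁ (_ , y) = contradiction (trans (sym y) (trans (sym same) x)) λ ()
      ... | inj₁ (x , _) | inj₁ (y , _) =
        0<⇒≢0 (convex-pos x y 0≤u u≤1) (trans (sym (blend l u)) (X.root t u eq))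
      ... | inj₂ (x , _) | inj₂ (y , _) = 0<⇒≢0 (convex-pos (strict p∦l x) (strict q∦l y) 0≤u u≤1)
        (trans (solve 4 (λ k x u y → k :* (:- x) :+ u :* (:- y) := :- (k :* x :+ u :* y)) refl
                 (1# - u) (cross (p ⊖ b) l) u (cross (q ⊖ b) l))
          (trans (cong -_ (trans (sym (blend l u)) (X.root t u eq))) -0#≈0#))

      side≢⇒crosses : side (p ⊖ b) ≢ side (q ⊖ b) → Crosses b l p q
      side≢⇒crosses differ with pos-view (cross (p ⊖ b) l) | pos-view (cross (q ⊖ b) l)
      ... | inj₁ (_ , x) | inj₁ (_ , y) = contradiction (trans x (sym y)) differ
      ... | inj₂ (_ , x) | inj₂ (_ , y) = contradiction (trans x (sym y)) differ
      ... | inj₁ (x , _) | inj₂ (y , _) = cross-at (balance-point x (strict q∦l y)) λ u eq →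
          trans (solve 4 (λ k x u y → k :* x :+ u :* y := k :* x :- u :* (:- y)) refl
                  (1# - u) (cross (p ⊖ b) l) u (cross (q ⊖ b) l)) eq
      ... | inj₂ (x , _) | inj₁ (y , _) = cross-at (balance-point (strict p∦l x) y) λ u eq →
          trans (solve 4 (λ k x u y → k :* x :+ u :* y := :- (k :* (:- x) :- u :* y)) refl
                  (1# - u) (cross (p ⊖ b) l) u (cross (q ⊖ b) l)) (trans (cong -_ eq) -0#≈0#)

-- Paths in acyclic plabic networks

module AcyclicDigraph {n} (G : Digraph n) (acyclic : Digraph.Acyclic G) where
  open Digraph G

  -- By acyclicity this is a strict order on a finite set, so it supports induction both against the
  -- orientation (prefixes) and along it (paths to the boundary).
  _≺_ : Edge → Edge → Set
  e ≺ f = TransClosure _⟶_ (source e) (source f)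

  ≺-isStrictPartialOrder : IsStrictPartialOrder _≡_ _≺_
  ≺-isStrictPartialOrder = record
    { isEquivalence = isEquivalence
    ; irrefl        = λ { refl → acyclic _ }
    ; trans         = _++_
    ; <-resp-≈      = (λ { refl p → p }) , (λ { refl p → p }) }

  consecutive : ∀ {e f} → target e ≡ source f → e ≺ f
  consecutive p = [ _ , refl , p ]

  incoming : ∀ v → indegree v ≢ 0 → ∃[ e ] target e ≡ v
  incoming v ≢0 with e , e∈ ← nonempty (inEdges v) ≢0 =
    e , proj₂ (∈-filter⁻ (λ e → target e ≟ᵥ v) {xs = allFin #edges} e∈)

  outgoing : ∀ v → outdegree v ≢ 0 → ∃[ e ] source e ≡ v
  outgoing v ≢0 with e , e∈ ← nonempty (outEdges v) ≢0 =
    e , proj₂ (∈-filter⁻ (λ e → source e ≟ᵥ v) {xs = allFin #edges} e∈)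

  path-to-boundary : NoInternalSinks → ∀ e → ∃[ j ] ∃[ F ] IsPath e j F
  path-to-boundary no-sinks e = go e (Fin.spo-noetherian ≺-isStrictPartialOrder e)
    where
    go : ∀ e → Acc (λ e f → f ≺ e) e → ∃[ j ] ∃[ F ] IsPath e j F
    go e (acc later) with target e in eq
    ... | inj₁ j = j , _ , end eq
    ... | inj₂ v with f , p ← outgoing (internal v) (no-sinks v)
      with j , F , P ← go f (later (consecutive (trans eq (sym p)))) = j , _ , trans eq (sym p) ▸ P

-- Winding and intersection numbers modulo 2 in a drawn network

module Drawing (ℝ : RealNumbers) {k n : ℕ} (N : Plabic.PlabicNetwork ℝ k n)
  (𝔩 : Plabic.GaugeRayDirection ℝ (Plabic.PlabicNetwork.graph N)) where
  open RealNumbers ℝ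
  open Plabic ℝ
  open OrderedField ℝ
  open Geometry ℝ
  open Segments ℝ
  open PlabicNetwork N
  open GaugeRayDirection 𝔩
  open Crossing l
  open Lines l
  open ≡-Reasoning

  b : Fin n → Point
  b j = position (boundary j)

  l>0 : 0# < cross l axis
  l>0 = subst (0# <_) (-cross axis l) (<0⇒0<- points-inside)

  open HalfPlane axis l>0

  ⊖-antisym : ∀ u v z → cross (u ⊖ v) z ≡ - cross (v ⊖ u) z
  ⊖-antisym (u₁ , u₂) (v₁ , v₂) (z₁ , z₂) = solve 6 (λ u₁ u₂ v₁ v₂ z₁ z₂ →
    (u₁ :- v₁) :* z₂ :- (u₂ :- v₂) :* z₁ := :- ((v₁ :- u₁) :* z₂ :- (v₂ :- u₂) :* z₁))
    refl u₁ u₂ v₁ v₂ z₁ z₂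

  internal-above : ∀ j v → 0# < cross (position (internal v) ⊖ b j) axis
  internal-above j v = subst (0# <_) (sym (trans (cong (λ y → cross (position (internal v) ⊖ y) axis) (on-axis j))
      (drop (position (internal v)) origin axis (abscissa j))))
    (subst (0# <_) (-cross axis _) (<0⇒0<- (inside-disk v)))
    where
    drop : ∀ x o n a → cross (x ⊖ (o ⊕ a ⊛ n)) n ≡ cross (x ⊖ o) n
    drop (x₁ , x₂) (o₁ , o₂) (n₁ , n₂) a = solve 7 (λ x₁ x₂ o₁ o₂ n₁ n₂ a →
      (x₁ :- (o₁ :+ a :* n₁)) :* n₂ :- (x₂ :- (o₂ :+ a :* n₂)) :* n₁ :=
      (x₁ :- o₁) :* n₂ :- (x₂ :- o₂) :* n₁) refl x₁ x₂ o₁ o₂ n₁ n₂ a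

  cross-boundary : ∀ i j z → cross (b i ⊖ b j) z ≡ cross axis z * (abscissa i - abscissa j)
  cross-boundary i j z = trans (cong₂ (λ x y → cross (x ⊖ y) z) (on-axis i) (on-axis j))
    (drop origin axis z (abscissa i) (abscissa j))
    where
    drop₁ : ∀ o n x y → (o + x * n) - (o + y * n) ≡ n * (x - y)
    drop₁ = solve 4 (λ o n x y → (o :+ x :* n) :- (o :+ y :* n) := n :* (x :- y)) refl
    drop : ∀ o n z x y → cross ((o ⊕ x ⊛ n) ⊖ (o ⊕ y ⊛ n)) z ≡ cross n z * (x - y)
    drop (o₁ , o₂) (n₁ , n₂) (z₁ , z₂) x y = trans
      (cong₂ (λ p q → p * z₂ - q * z₁) (drop₁ o₁ n₁ x y) (drop₁ o₂ n₂ x y))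
      (solve 5 (λ n₁ n₂ z₁ z₂ d → n₁ :* d :* z₂ :- n₂ :* d :* z₁ := (n₁ :* z₂ :- n₂ :* z₁) :* d)
        refl n₁ n₂ z₁ z₂ (x - y))

  boundary-level : ∀ i j → cross (b i ⊖ b j) axis ≡ 0#
  boundary-level i j = trans (cross-boundary i j axis)
    (trans (cong (_* (abscissa i - abscissa j)) (self axis)) (solve 1 (λ x → con (+ 0) :* x := con (+ 0)) refl _))
    where
    self : ∀ n → cross n n ≡ 0#
    self (n₁ , n₂) = solve 2 (λ n₁ n₂ → n₁ :* n₂ :- n₂ :* n₁ := con (+ 0)) refl n₁ n₂

  boundary-off-line : ∀ {i j} → i ≢ j → cross (b i ⊖ b j) l ≢ 0#
  boundary-off-line {i} {j} i≢j ≡0 = i≢j (inj₁-injective (injective (begin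
    b i                              ≡⟨ on-axis i ⟩
    origin ⊕ abscissa i ⊛ axis       ≡⟨ cong (λ a → origin ⊕ a ⊛ axis) same ⟩
    origin ⊕ abscissa j ⊛ axis       ≡⟨ on-axis j ⟨
    b j                              ∎)))
    where
    axis∦l : cross axis l ≢ 0#
    axis∦l z = 0<⇒≢0 l>0 (trans (cross-antisym l axis) (trans (cong -_ z) -0#≈0#))
    same : abscissa i ≡ abscissa j
    same = begin
      abscissa i                                   ≡⟨ solve 2 (λ x y → x := (x :- y) :+ y) refl (abscissa i) (abscissa j) ⟩
      (abscissa i - abscissa j) + abscissa j       ≡⟨ cong (_+ abscissa j) (*-nonzero (trans (sym (cross-boundary i j l)) ≡0) axis∦l) ⟩
      0# + abscissa j                              ≡⟨ solve 1 (λ y → con (+ 0) :+ y := y) refl (abscissa j) ⟩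
      abscissa j                                   ∎

  -- An internal vertex lies above the boundary line and `l` points upwards, so on the line of `l`
  -- through `b j` it would be at a positive parameter, on the ray itself.
  internal-off-line : ∀ j v → cross (position (internal v) ⊖ b j) l ≢ 0#
  internal-off-line j v ≡0 = avoids-internal j v (t , inj₁ 0<t , eq)
    where
    x = position (internal v) ⊖ b j
    inv = inverse (cross l axis) (0<⇒≢0 l>0)
    t = cross x axis * proj₁ inv
    0<t : 0# < t
    0<t = *-pos _ _ (internal-above j v) (0<-inverse l>0 (proj₂ inv))
    restore : ∀ p q → p ≡ q ⊕ (p ⊖ q)
    restore (p₁ , p₂) (q₁ , q₂) = cong₂ _,_ (r p₁ q₁) (r p₂ q₂)
      where
      r : ∀ p q → p ≡ q + (p - q)
      r = solve 2 (λ p q → p := q :+ (p :- q)) refl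
    eq : position (internal v) ≡ b j ⊕ t ⊛ l
    eq = trans (restore (position (internal v)) (b j)) (cong (b j ⊕_)
      (sym (Intersection.parallel l axis (proj₁ inv) (proj₂ inv) (b j) (b j) (b j) x ≡0)))

  reverse-off-line : ∀ u v → cross (u ⊖ v) l ≢ 0# → cross (v ⊖ u) l ≢ 0#
  reverse-off-line u v u∦v z = u∦v (trans (⊖-antisym u v l) (trans (cong -_ z) -0#≈0#))

  -- The gauge condition speaks of internal edges only. An edge between a boundary and an internal
  -- vertex parallel to `l` would put the internal vertex on a ray, and an edge between two boundary
  -- vertices is parallel to `axis`.
  nonparallel : ∀ e → cross (vector e) l ≢ 0#
  nonparallel e = go (source e) (target e) refl refl
    where
    go : ∀ u v → source e ≡ u → target e ≡ v → cross (vector e) l ≢ 0#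
    go (inj₂ u) (inj₂ v) p q = not-parallel e ((u , p) , (v , q))
    go (inj₁ i) (inj₂ v) p q = subst₂ (λ u v → cross (position v ⊖ position u) l ≢ 0#)
      (sym p) (sym q) (internal-off-line i v)
    go (inj₂ u) (inj₁ j) p q = subst₂ (λ u v → cross (position v ⊖ position u) l ≢ 0#)
      (sym p) (sym q) (reverse-off-line (position (internal u)) (b j) (internal-off-line j u))
    go (inj₁ i) (inj₁ j) p q = subst₂ (λ u v → cross (position v ⊖ position u) l ≢ 0#)
      (sym p) (sym q) (boundary-off-line λ { refl → no-loops e (trans p (sym q)) })

  sink : ∀ {e j} → target e ≡ boundary j → j ∉ I
  sink {e} {j} p j∈I = length≢0 (∈-filter⁺ (λ e → target e ≟ᵥ boundary j) (∈-allFin e) p)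
    (proj₁ (boundary-source j∈I))

  no-through-boundary : ∀ {e f j} → target e ≡ boundary j → source f ≢ boundary j
  no-through-boundary {f = f} {j} p q =
    length≢0 (∈-filter⁺ (λ e → source e ≟ᵥ boundary j) (∈-allFin f) q)
      (proj₂ (boundary-sink (sink p)))

  through-internal : ∀ {e f} → target e ≡ source f → ∃[ v ] target e ≡ internal v
  through-internal {e} {f} p = go (target e) refl
    where
    go : ∀ v → target e ≡ v → ∃[ v ] target e ≡ internal v
    go (inj₁ j) q = contradiction (trans (sym p) q) (no-through-boundary q)
    go (inj₂ v) q = v , q

  last-edge : ∀ {e j F} → IsPath e j F → ∃[ g ] target g ≡ boundary j
  last-edge (end p) = _ , p
  last-edge (_ ▸ P) = last-edge P

  windχ : List Edge → Parity
  windχ (e ∷ f ∷ F) = χ (vector e) (vector f) ℙ.+ windχ (f ∷ F)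
  windχ _           = 0ℙ

  parity-windₚ : ∀ F → parityℤ (windₚ F) ≡ windχ F
  parity-windₚ []          = refl
  parity-windₚ (e ∷ [])    = refl
  parity-windₚ (e ∷ f ∷ F) = trans (parity-∣+∣ (windₗ l (vector e) (vector f)) (windₚ (f ∷ F)))
    (cong₂ ℙ._+_ (windₗ-χ (vector e) (vector f) (nonparallel e) (nonparallel f)) (parity-windₚ (f ∷ F)))

  -- The change of direction modulo 2 of the secant from x to a point that
  -- runs along the edges.
  fan : Point → List Edge → Parity
  fan x = sumℙ λ g → χ (position (source g) ⊖ x) (position (target g) ⊖ x)

  module Acyclicity (acyclic : Acyclic) where
    open AcyclicDigraph digraph acyclic public

    private
      step : ∀ e → source e ⟶ target e
      step e = e , refl , refl

    -- By planarity a common point is a common endpoint, and each of the four possible coincidences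
    -- of endpoints closes a directed cycle.
    apart : ∀ {e f} → TransClosure _⟶_ (target e) (source f) →
            ¬ Meet (position (source e)) (position (target e)) (position (source f)) (position (target f))
    apart {e} {f} reach (z , z∈e , z∈f)
      with planar (λ { refl → acyclic _ (step e ∷ reach) }) z z∈e z∈f
    ... | _ , _ , inj₁ refl , inj₁ p = acyclic _ (subst (TransClosure _⟶_ _) (sym p) (step e ∷ reach))
    ... | _ , _ , inj₁ refl , inj₂ p = acyclic _ (subst (TransClosure _⟶_ _) (sym p) ((step e ∷ reach) ∷ʳ step f))
    ... | _ , _ , inj₂ refl , inj₁ p = acyclic _ (subst (TransClosure _⟶_ _) (sym p) reach)
    ... | _ , _ , inj₂ refl , inj₂ p = acyclic _ (subst (TransClosure _⟶_ _) (sym p) (reach ∷ʳ step f))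

    corner : ∀ {e f} → target e ≡ source f → ∀ z →
             OnSegment (position (source e)) (position (target e)) z →
             OnSegment (position (target e)) (position (target f)) z → z ≡ position (target e)
    corner {e} {f} p z z∈e z∈f
      with planar (λ { refl → no-loops e (sym p) }) z z∈e
                  (subst (λ v → OnSegment (position v) (position (target f)) z) p z∈f)
    ... | _ , _ , inj₁ refl , inj₁ q = contradiction (trans q (sym p)) (no-loops e)
    ... | _ , _ , inj₁ refl , inj₂ q = contradiction (e , refl , p) λ s →
            acyclic _ (subst (TransClosure _⟶_ _) (sym q) (s ∷ [ step f ]))
    ... | _ , z≡ , inj₂ refl , _ = z≡

    Below : Fin n → Edge → Set
    Below j e = χ (b j ⊖ position (source e)) (b j ⊖ position (target e)) ≡ 0ℙ

    -- Secants that end at `b j` never point into the disk, whereas `l` does, so their direction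
    -- cannot pass through `l`.
    below : ∀ j {e f} → target e ≡ source f → Below j e
    below j {e} {f} p = go (source e) refl
      where
      v = proj₁ (through-internal p)
      below-internal : ∀ v → 0# ≤ - cross (b j ⊖ position (internal v)) axis
      below-internal v = inj₁ (subst (0# <_)
        (⊖-antisym (position (internal v)) (b j) axis) (internal-above j v))
      tgt : 0# ≤ - cross (b j ⊖ position (target e)) axis
      tgt = subst (λ v → 0# ≤ - cross (b j ⊖ position v) axis) (sym (proj₂ (through-internal p))) (below-internal v)
      conclude : 0# ≤ - cross (b j ⊖ position (source e)) axis → Below j e
      conclude src = χ-lower _ _ src tgt
      go : ∀ u → source e ≡ u → Below j e
      go (inj₁ i) q = conclude (subst (λ u → 0# ≤ - cross (b j ⊖ position u) axis) (sym q)
        (inj₂ (sym (trans (cong -_ (boundary-level j i)) -0#≈0#))))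
      go (inj₂ u) q = conclude (subst (λ u → 0# ≤ - cross (b j ⊖ position u) axis) (sym q) (below-internal u))

    module _ (e : Edge) where
      private
        p₀ = position (source e)
        p₁ = position (target e)

      -- The counterpart of `fan` for a moving tail: the head stays at `v` while the tail runs along
      -- `e`.
      secant : Vertex → Parity
      secant v = χ (position v ⊖ p₀) (position v ⊖ p₁)

      cell : ∀ {f} → TransClosure _⟶_ (target e) (source f) →
             χ (position (source f) ⊖ p₀) (position (target f) ⊖ p₀) ℙ.+ secant (target f) ≡
             secant (source f) ℙ.+ χ (position (source f) ⊖ p₁) (position (target f) ⊖ p₁)
      cell reach = χ-cell _ _ _ _ (apart reach)

      -- Glues the cells of `e` with the successive edges of the path; the common sides of
      -- neighbouring cells cancel.
      fan-shift : ∀ {f j F} → IsPath f j F → TransClosure _⟶_ (target e) (source f) →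
                  fan p₀ F ℙ.+ secant (boundary j) ≡ secant (source f) ℙ.+ fan p₁ F
      fan-shift {f} {j} (end p) reach = begin
        (A ℙ.+ 0ℙ) ℙ.+ secant (boundary j)   ≡⟨ cong₂ (λ x v → x ℙ.+ secant v) (ℙ.+-identityʳ A) (sym p) ⟩
        A ℙ.+ secant (target f)              ≡⟨ cell reach ⟩
        secant (source f) ℙ.+ B              ≡⟨ cong (secant (source f) ℙ.+_) (ℙ.+-identityʳ B) ⟨
        secant (source f) ℙ.+ (B ℙ.+ 0ℙ)     ∎
        where
        A = χ (position (source f) ⊖ p₀) (position (target f) ⊖ p₀)
        B = χ (position (source f) ⊖ p₁) (position (target f) ⊖ p₁)
      fan-shift {f} {j} (_▸_ {f = g} {F = F} p P) reach = begin
        (A ℙ.+ fan p₀ F) ℙ.+ secant (boundary j)        ≡⟨ ℙ.+-assoc A _ _ ⟩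
        A ℙ.+ (fan p₀ F ℙ.+ secant (boundary j))        ≡⟨ cong (A ℙ.+_) (fan-shift P (reach ∷ʳ (f , refl , p))) ⟩
        A ℙ.+ (secant (source g) ℙ.+ fan p₁ F)          ≡⟨ cong (λ v → A ℙ.+ (secant v ℙ.+ fan p₁ F)) p ⟨
        A ℙ.+ (secant (target f) ℙ.+ fan p₁ F)          ≡⟨ ℙ.+-assoc A _ _ ⟨
        (A ℙ.+ secant (target f)) ℙ.+ fan p₁ F          ≡⟨ cong (ℙ._+ fan p₁ F) (cell reach) ⟩
        (secant (source f) ℙ.+ B) ℙ.+ fan p₁ F          ≡⟨ ℙ.+-assoc (secant (source f)) _ _ ⟩
        secant (source f) ℙ.+ (B ℙ.+ fan p₁ F)          ∎
        where
        A = χ (position (source f) ⊖ p₀) (position (target f) ⊖ p₀)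
        B = χ (position (source f) ⊖ p₁) (position (target f) ⊖ p₁)

      fan-shift-tail : ∀ {f f′ j F} → target e ≡ source f → IsPath f j (f′ ∷ F) →
                       fan p₀ F ℙ.+ secant (boundary j) ≡ secant (target f) ℙ.+ fan p₁ F
      fan-shift-tail {j = j} e▸f (end p) = trans (cong secant (sym p)) (sym (ℙ.+-identityʳ _))
      fan-shift-tail {f} e▸f (_▸_ {F = F} p P) = trans (fan-shift P [ f , sym e▸f , p ])
        (cong (λ v → secant v ℙ.+ fan p₁ F) (sym p))

    private
      -- One strip of Hopf's triangle: the tail of the secant moves across `e`. The end of the strip
      -- at `b j` contributes zero by `below`, and its other end is the half cell at the corner of
      -- `e` and `f`, where `χ-triangle` produces the new term of `windχ`.
      wind-step : ∀ {e f j F} → target e ≡ source f → IsPath f j (f ∷ F) →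
                  fan (position (source f)) F ≡ windχ (f ∷ F) →
                  fan (position (source e)) (f ∷ F) ≡ windχ (e ∷ f ∷ F)
      wind-step {e} {f} {j} {F} p P ih = begin
        A ℙ.+ fan p₀ F                                    ≡⟨ cong (A ℙ.+_) (ℙ.+-identityʳ _) ⟨
        A ℙ.+ (fan p₀ F ℙ.+ 0ℙ)                           ≡⟨ cong (λ x → A ℙ.+ (fan p₀ F ℙ.+ x)) (below j p) ⟨
        A ℙ.+ (fan p₀ F ℙ.+ secant e (boundary j))        ≡⟨ cong (A ℙ.+_) (fan-shift-tail e p P) ⟩
        A ℙ.+ (secant e (target f) ℙ.+ fan p₁ F)          ≡⟨ ℙ.+-assoc A _ _ ⟨
        (A ℙ.+ secant e (target f)) ℙ.+ fan p₁ F          ≡⟨ cong₂ ℙ._+_ triangle (trans (cong (λ u → fan (position u) F) p) ih) ⟩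
        χ (vector e) (vector f) ℙ.+ windχ (f ∷ F)         ∎
        where
        p₀ = position (source e)
        p₁ = position (target e)
        p₂ = position (target f)
        A = χ (position (source f) ⊖ p₀) (p₂ ⊖ p₀)
        triangle : A ℙ.+ secant e (target f) ≡ χ (vector e) (vector f)
        triangle = subst
          (λ u → χ (position u ⊖ p₀) (p₂ ⊖ p₀) ℙ.+ secant e (target f) ≡ χ (vector e) (p₂ ⊖ position u)) p
          (χ-triangle (p₁ ⊖ p₀) (p₂ ⊖ p₀) (p₂ ⊖ p₁)
            (corner-avoids p₀ p₁ p₂ (no-loops e ∘ injective)
              (λ q → no-loops f (trans (sym p) (injective q))) (corner p)))

    -- The discrete Umlaufsatz, obtained by stacking the strips of `wind-step`. The fan omits the
    -- first edge, along which the secant from its source keeps its direction.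
    fan-wind : ∀ {e j F} → IsPath e j (e ∷ F) → fan (position (source e)) F ≡ windχ (e ∷ F)
    fan-wind (end _)         = refl
    fan-wind (p ▸ P@(end _)) = wind-step p P (fan-wind P)
    fan-wind (p ▸ P@(_ ▸ _)) = wind-step p P (fan-wind P)

    -- All points after the first lie above the boundary, so their directions
    -- as seen from the boundary vertex b i stay in a half-plane containing l.
    fan-boundary : ∀ i {f j F v} → i ≢ j → source f ≡ internal v → IsPath f j F →
                   fan (b i) F ≡ side (position (source f) ⊖ b i) ℙ.+ side (b j ⊖ b i)
    fan-boundary i {f} {j} {v = v} i≢j src (end p) = begin
      χ (position (source f) ⊖ b i) (position (target f) ⊖ b i) ℙ.+ 0ℙ
        ≡⟨ ℙ.+-identityʳ _ ⟩
      χ (position (source f) ⊖ b i) (position (target f) ⊖ b i)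
        ≡⟨ cong (λ u → χ (position (source f) ⊖ b i) (position u ⊖ b i)) p ⟩
      χ (position (source f) ⊖ b i) (b j ⊖ b i)
        ≡⟨ χ-upper _ _ (subst (λ u → 0# < cross (position u ⊖ b i) axis) (sym src) (internal-above i v))
             (inj₂ (boundary-level j i , boundary-off-line (i≢j ∘ sym))) ⟩
      side (position (source f) ⊖ b i) ℙ.+ side (b j ⊖ b i) ∎
    fan-boundary i {f} {j} {v = v} i≢j src (_▸_ {f = g} {F = F} p P) = begin
      χ (position (source f) ⊖ b i) (position (target f) ⊖ b i) ℙ.+ fan (b i) F
        ≡⟨ cong₂ ℙ._+_
             (χ-upper _ _ (subst (λ u → 0# < cross (position u ⊖ b i) axis) (sym src) (internal-above i v))
               (inj₁ (subst (λ u → 0# < cross (position u ⊖ b i) axis) (sym tgt) (internal-above i v′))))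
             (trans (fan-boundary i i≢j (trans (sym p) tgt) P)
                    (cong (λ u → side (position u ⊖ b i) ℙ.+ side (b j ⊖ b i)) (sym p))) ⟩
      (side (position (source f) ⊖ b i) ℙ.+ side (position (target f) ⊖ b i)) ℙ.+
      (side (position (target f) ⊖ b i) ℙ.+ side (b j ⊖ b i))
        ≡⟨ telescope (side (position (source f) ⊖ b i)) _ _ ⟩
      side (position (source f) ⊖ b i) ℙ.+ side (b j ⊖ b i) ∎
      where
      v′ = proj₁ (through-internal p)
      tgt = proj₂ (through-internal p)

    private
      initial : Fin n → Fin n → Edge → Parity
      initial i j e = side (vector e) ℙ.+ side (b j ⊖ b i)

      continue : ∀ {i e f j F} → source e ≡ boundary i → target e ≡ source f → IsPath f j (f ∷ F) →
                 windχ (e ∷ f ∷ F) ≡ initial i j e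
      continue {i} {e} {f} {j} {F} src p P = begin
        windχ (e ∷ f ∷ F)                                      ≡⟨ fan-wind (p ▸ P) ⟨
        fan (position (source e)) (f ∷ F)                      ≡⟨ cong (λ u → fan (position u) (f ∷ F)) src ⟩
        fan (b i) (f ∷ F)                                      ≡⟨ fan-boundary i i≢j (trans (sym p) (proj₂ (through-internal p))) P ⟩
        side (position (source f) ⊖ b i) ℙ.+ side (b j ⊖ b i)  ≡⟨ cong₂ (λ u v → side (position u ⊖ position v) ℙ.+ side (b j ⊖ b i)) p src ⟨
        side (vector e) ℙ.+ side (b j ⊖ b i)                   ∎
        where
        i≢j : i ≢ j
        i≢j refl = no-through-boundary (proj₂ (last-edge P)) src

    wind-from-boundary : ∀ {i e j F} → source e ≡ boundary i → IsPath e j F →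
                         windχ F ≡ side (vector e) ℙ.+ side (b j ⊖ b i)
    wind-from-boundary src (end p) =
      sym (≡⇒+≡0 (cong₂ (λ u v → side (position u ⊖ position v)) p src))
    wind-from-boundary src (p ▸ P@(end _)) = continue src p P
    wind-from-boundary src (p ▸ P@(_ ▸ _)) = continue src p P

    -- One prefix serves all paths from `e`, whatever their ends, so `offset` is the same for all of
    -- them and cancels in comparisons.
    record Extension (e : Edge) : Set where
      field
        root   : Fin n
        first  : Edge
        starts : source first ≡ boundary root
        offset : Parity
        extend : ∀ {j F} → IsPath e j F → ∃[ F′ ] IsPath first j F′ × windχ F′ ≡ offset ℙ.+ windχ F

    private
      prepend : ∀ {e f j F} → target e ≡ source f → IsPath f j F →
                windχ (e ∷ F) ≡ χ (vector e) (vector f) ℙ.+ windχ F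
      prepend p (end _) = refl
      prepend p (_ ▸ _) = refl

    extension : NoInternalSources → ∀ e → Extension e
    extension no-sources e = go e (Fin.spo-wellFounded ≺-isStrictPartialOrder e)
      where
      go : ∀ e → Acc _≺_ e → Extension e
      go e (acc earlier) with source e in eq
      ... | inj₁ i = record
        { root = i ; first = e ; starts = eq ; offset = 0ℙ ; extend = λ P → _ , P , refl }
      ... | inj₂ v with d , p ← incoming (internal v) (no-sources v) = record
        { root = X.root ; first = X.first ; starts = X.starts ; offset = X.offset ℙ.+ χ (vector d) (vector e)
        ; extend = λ P → let (F′ , P′ , q) = X.extend (d▸e ▸ P) in
            F′ , P′ , trans q (trans (cong (X.offset ℙ.+_) (prepend d▸e P)) (sym (ℙ.+-assoc X.offset _ _))) }
        where
        d▸e : target d ≡ source e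
        d▸e = trans p (sym eq)
        module X = Extension (go d (earlier [ d , refl , p ]))

    wind-invariant : NoInternalSources → ∀ {e j F F′} → IsPath e j F → IsPath e j F′ →
                     windχ F ≡ windχ F′
    wind-invariant no-sources {e} {j} {F} {F′} P P′
      with G , Q , q ← Extension.extend (extension no-sources e) P
         | G′ , Q′ , q′ ← Extension.extend (extension no-sources e) P′ =
      ℙ.+-cancelˡ-≡ (Extension.offset (extension no-sources e)) _ _ (trans (sym q) (trans
        (trans (wind-from-boundary starts Q) (sym (wind-from-boundary starts Q′))) q′))
      where open Extension (extension no-sources e) using (starts)

  -- The parity of the number of source rays whose lines have `v` on the right; it acts as a
  -- potential for `int`.
  levels : Vertex → Parity
  levels v = sumℙ (λ r → side (position v ⊖ b (i r))) (allFin k)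

  i-∈ : ∀ r → i r ∈ I
  i-∈ r = elements-∈ I _

  target-off-line : ∀ e r → cross (position (target e) ⊖ b (i r)) l ≢ 0# ×
                            0# ≤ cross (position (target e) ⊖ b (i r)) axis
  target-off-line e r = go (target e) refl
    where
    Goal : Vertex → Set
    Goal v = cross (position v ⊖ b (i r)) l ≢ 0# × 0# ≤ cross (position v ⊖ b (i r)) axis
    go : ∀ v → target e ≡ v → Goal (target e)
    go (inj₁ j) p = subst Goal (sym p)
      (boundary-off-line (λ { refl → sink p (i-∈ r) }) , inj₂ (sym (boundary-level j (i r))))
    go (inj₂ v) p = subst Goal (sym p) (internal-off-line (i r) v , inj₁ (internal-above (i r) v))

  -- Above the boundary, an edge meets a ray exactly when its ends are on different sides of the
  -- line of the ray. The source has to be internal, because a boundary source lies on the line of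
  -- its own ray.
  parity-int : ∀ e {v} → source e ≡ internal v → parity (int e) ≡ levels (source e) ℙ.+ levels (target e)
  parity-int e {v} src = trans
    (parity-length-filter (meetsRay? e) _
      (λ r m → ≢⇒+≡1 (R.crosses⇒side≢ r m))
      (λ r ¬m → ≡⇒+≡0 (same r ¬m)) (allFin k))
    (sumℙ-+ (λ r → side (position (source e) ⊖ b (i r))) (λ r → side (position (target e) ⊖ b (i r))) (allFin k))
    where
    module R (r : Fin k) = Rays axis l>0 (b (i r)) (position (source e)) (position (target e))
      (subst (λ u → 0# < cross (position u ⊖ b (i r)) axis) (sym src) (internal-above (i r) v))
      (proj₂ (target-off-line e r))
      (subst (λ u → cross (position u ⊖ b (i r)) l ≢ 0#) (sym src) (internal-off-line (i r) v))
      (proj₁ (target-off-line e r))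
    same : ∀ r → ¬ MeetsRay e r → side (position (source e) ⊖ b (i r)) ≡ side (position (target e) ⊖ b (i r))
    same r ¬m with side (position (source e) ⊖ b (i r)) ℙ.≟ side (position (target e) ⊖ b (i r))
    ... | yes p = p
    ... | no ¬p = contradiction (R.side≢⇒crosses r ¬p) ¬m

  parity-intₚ-internal : ∀ {e j F v} → source e ≡ internal v → IsPath e j F →
                         parity (intₚ F) ≡ levels (source e) ℙ.+ levels (boundary j)
  parity-intₚ-internal {e} src (end p) = trans (cong parity (ℕ.+-identityʳ (int e)))
    (trans (parity-int e src) (cong (λ v → levels (source e) ℙ.+ levels v) p))
  parity-intₚ-internal {e} {j} src (_▸_ {f = f} {F = F} p P) = begin
    parity (int e ℕ.+ intₚ F)                ≡⟨ ℙ.+-homo-+ (int e) (intₚ F) ⟩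
    parity (int e) ℙ.+ parity (intₚ F)       ≡⟨ cong₂ ℙ._+_ (parity-int e src)
                                                  (parity-intₚ-internal (trans (sym p) (proj₂ (through-internal p))) P) ⟩
    (levels (source e) ℙ.+ levels (target e)) ℙ.+ (levels (source f) ℙ.+ levels (boundary j))
      ≡⟨ cong (λ v → (levels (source e) ℙ.+ levels (target e)) ℙ.+ (levels v ℙ.+ levels (boundary j))) p ⟨
    (levels (source e) ℙ.+ levels (target e)) ℙ.+ (levels (target e) ℙ.+ levels (boundary j))
      ≡⟨ telescope (levels (source e)) (levels (target e)) (levels (boundary j)) ⟩
    levels (source e) ℙ.+ levels (boundary j) ∎

  -- The first edge may start at a boundary source, so its `int` is left as it is; it is common to
  -- all paths from `e`. The potential handles the rest.
  parity-intₚ : ∀ {e j F} → IsPath e j F →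
                parity (intₚ F) ≡ parity (int e) ℙ.+ (levels (target e) ℙ.+ levels (boundary j))
  parity-intₚ {e} (end p) = trans (cong parity (ℕ.+-identityʳ (int e)))
    (trans (sym (ℙ.+-identityʳ _)) (cong (parity (int e) ℙ.+_) (sym (≡⇒+≡0 (cong levels p)))))
  parity-intₚ {e} {j} (_▸_ {F = F} p P) = trans (ℙ.+-homo-+ (int e) (intₚ F)) (cong (parity (int e) ℙ.+_)
    (trans (parity-intₚ-internal (trans (sym p) (proj₂ (through-internal p))) P)
           (cong (λ v → levels v ℙ.+ levels (boundary j)) (sym p))))

  windInt-invariant : Acyclic → NoInternalSources →
                      ∀ {e j F F′} → IsPath e j F → IsPath e j F′ → windInt F ≡ windInt F′
  windInt-invariant acyclic no-sources {F = F} {F′} P P′ = begin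
    windInt F                                   ≡⟨ split F ⟩
    windχ F ℙ.+ parity (intₚ F)                 ≡⟨ cong₂ ℙ._+_ (wind-invariant no-sources P P′)
                                                     (trans (parity-intₚ P) (sym (parity-intₚ P′))) ⟩
    windχ F′ ℙ.+ parity (intₚ F′)               ≡⟨ split F′ ⟨
    windInt F′                                  ∎
    where
    open Acyclicity acyclic
    split : ∀ F → windInt F ≡ windχ F ℙ.+ parity (intₚ F)
    split F = trans (parity-∣+∣ (windₚ F) (+ intₚ F)) (cong (ℙ._+ parity (intₚ F)) (parity-windₚ F))

-- Edge vectors

module Sums (ℝ : RealNumbers) where
  open RealNumbers ℝ
  open Plabic ℝ
  open OrderedField ℝ
  open CommutativeRing commutativeRing using (+-identityˡ; +-identityʳ; zeroʳ; *-identityˡ)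
  open ≡-Reasoning

  ∑-cong : ∀ {A : Set} (xs : List A) {f g : A → Carrier} → (∀ x → x List.∈ xs → f x ≡ g x) → ∑ xs f ≡ ∑ xs g
  ∑-cong []       eq = refl
  ∑-cong (x ∷ xs) eq = cong₂ _+_ (eq x (here refl)) (∑-cong xs (λ y → eq y ∘ there))

  ∑-zero : ∀ {A : Set} (xs : List A) {f : A → Carrier} → (∀ x → x List.∈ xs → f x ≡ 0#) → ∑ xs f ≡ 0#
  ∑-zero []       eq = refl
  ∑-zero (x ∷ xs) eq =
    trans (cong₂ _+_ (eq x (here refl)) (∑-zero xs (λ y → eq y ∘ there))) (+-identityˡ 0#)

  ∑-*ˡ : ∀ {A : Set} (xs : List A) c (f : A → Carrier) → ∑ xs (λ x → c * f x) ≡ c * ∑ xs f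
  ∑-*ˡ []       c f = sym (zeroʳ c)
  ∑-*ˡ (x ∷ xs) c f = trans (cong (λ y → c * f x + y) (∑-*ˡ xs c f))
    (solve 3 (λ c a b → c :* a :+ c :* b := c :* (a :+ b)) refl c (f x) (∑ xs f))

  ∑-single : ∀ {A : Set} {xs : List A} {x} {f : A → Carrier} → Unique xs → x List.∈ xs →
             (∀ y → y ≢ x → f y ≡ 0#) → ∑ xs f ≡ f x
  ∑-single {xs = x ∷ xs} {f = f} (x∉ ∷ _) (here refl) vanish = trans
    (cong (λ y → f x + y) (∑-zero xs λ y y∈ → vanish y λ { refl → All.lookup x∉ y∈ refl }))
    (+-identityʳ _)
  ∑-single {xs = y ∷ xs} {x} {f} (y∉ ∷ u) (there x∈) vanish =
    trans (cong₂ _+_ (vanish y λ { refl → All.lookup y∉ x∈ refl }) (∑-single u x∈ vanish)) (+-identityˡ _)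

  ∑-pos : ∀ {A : Set} (xs : List A) {f : A → Carrier} → (∀ x → 0# < f x) → 0# ≤ ∑ xs f
  ∑-pos []       0<f = inj₂ refl
  ∑-pos (x ∷ xs) 0<f = inj₁ (0<-+-0≤ (0<f x) (∑-pos xs 0<f))

  ∑-pos-nonempty : ∀ {A : Set} {xs : List A} {x} {f : A → Carrier} → x List.∈ xs → (∀ x → 0# < f x) → 0# < ∑ xs f
  ∑-pos-nonempty {xs = x ∷ xs} _ 0<f = 0<-+-0≤ (0<f x) (∑-pos xs 0<f)

  ∑-sign : ∀ {A : Set} (xs : List A) (φ : A → Parity) (f : A → Carrier) p →
           (∀ x → x List.∈ xs → φ x ≡ p) → ∑ xs (λ x → sign (φ x) * f x) ≡ sign p * ∑ xs f
  ∑-sign xs φ f p eq =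
    trans (∑-cong xs (λ x x∈ → cong (λ q → sign q * f x) (eq x x∈))) (∑-*ˡ xs (sign p) f)

  sign-nonzero : ∀ p {x} → 0# < x → sign p * x ≢ 0#
  sign-nonzero 0ℙ {x} 0<x z = 0<⇒≢0 0<x (trans (sym (*-identityˡ x)) z)
  sign-nonzero 1ℙ {x} 0<x z = 0<⇒≢0 0<x (begin
    x                ≡⟨ *-identityˡ x ⟨
    1# * x           ≡⟨ solve 2 (λ e x → e :* x := :- ((:- e) :* x)) refl 1# x ⟩
    - (- 1# * x)     ≡⟨ cong -_ z ⟩
    - 0#             ≡⟨ -0#≈0# ⟩
    0#               ∎)

module EdgeVectors (ℝ : RealNumbers) {k n : ℕ} (N : Plabic.PlabicNetwork ℝ k n)
  (𝔩 : Plabic.GaugeRayDirection ℝ (Plabic.PlabicNetwork.graph N)) where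
  open RealNumbers ℝ
  open Plabic ℝ
  open OrderedField ℝ
  open CommutativeRing commutativeRing using (zeroʳ; *-identityʳ)
  open Sums ℝ
  open PlabicNetwork N
  open GaugeRayDirection 𝔩
  open Drawing ℝ N 𝔩

  w-pos : ∀ F → 0# < w F
  w-pos []      = 0<1
  w-pos (e ∷ F) = *-pos _ _ (positive e) (w-pos F)

  no-paths : ∀ {e m F} → m ∈ I → ¬ IsPath e m F
  no-paths m∈I P = sink (proj₂ (last-edge P)) m∈I

  expansion : (g : Fin n → Carrier) → (∀ m → m ∈ I → g m ≡ 0#) →
              ∀ m → g m ≡ ∑ Ī (λ j → g j * canonicalBasis N 𝔩 j m)
  expansion g g≡0 m with m ∈? I
  ... | no m∉I = sym (trans
    (∑-single (Unique.filter⁺ (λ j → ¬? (j ∈? I)) (Unique.allFin⁺ n)) (∈-filter⁺ (λ j → ¬? (j ∈? I)) (∈-allFin m) m∉I)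
      off-diagonal)
    (trans (cong (λ b → g m * (if b then 1# else 0#)) (dec-true (m Fin.≟ m) refl)) (*-identityʳ _)))
    where
    off-diagonal : ∀ j → j ≢ m → g j * canonicalBasis N 𝔩 j m ≡ 0#
    off-diagonal j j≢m = trans (cong (λ b → g j * (if b then 1# else 0#)) (dec-false (j Fin.≟ m) j≢m)) (zeroʳ _)
  ... | yes m∈I = trans (g≡0 m m∈I) (sym (∑-zero Ī vanish))
    where
    vanish : ∀ j → j List.∈ Ī → g j * canonicalBasis N 𝔩 j m ≡ 0#
    vanish j j∈Ī = trans (cong (λ b → g j * (if b then 1# else 0#)) (dec-false (j Fin.≟ m) j≢m)) (zeroʳ _)
      where
      j≢m : j ≢ m
      j≢m refl = proj₂ (∈-filter⁻ (λ j → ¬? (j ∈? I)) {xs = allFin n} j∈Ī) m∈I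

  module _ (acyclic : Acyclic) (no-sources : NoInternalSources) where

    -- Read off from the first listed path. If there is none, the default `0ℙ` multiplies an empty
    -- sum.
    σ : Edge → Fin n → Parity
    σ e j = headParity windInt (paths e j)

    σ-path : ∀ {e j F} → IsPath e j F → windInt F ≡ σ e j
    σ-path {e} {j} {F} P = headParity-const windInt (paths-complete acyclic P)
      λ G∈ → windInt-invariant acyclic no-sources P (paths-sound G∈)

    σ-factor : ∀ e j → edgeVector N 𝔩 e j ≡ sign (σ e j) * ∑ (paths e j) w
    σ-factor e j = ∑-sign (paths e j) windInt w (σ e j) λ F F∈ → σ-path (paths-sound F∈)

    edgeVector-source : ∀ e m → m ∈ I → edgeVector N 𝔩 e m ≡ 0#
    edgeVector-source e m m∈I = ∑-zero (paths e m) λ F F∈ → contradiction (paths-sound F∈) (no-paths m∈I)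

    edgeVectorFormula : EdgeVectorFormula N 𝔩
    edgeVectorFormula = σ , λ e →
      (λ j _ F P → σ-path P) ,
      expansion (edgeVector N 𝔩 e) (edgeVector-source e) ,
      λ m → trans (expansion (edgeVector N 𝔩 e) (edgeVector-source e) m)
                  (∑-cong Ī λ j _ → cong (_* canonicalBasis N 𝔩 j m) (σ-factor e j))

    -- All terms of a component carry the same sign, so nothing cancels, and one path from `e` to
    -- the boundary makes that component nonzero.
    edgeVectorsNonNull : NoInternalSinks → EdgeVectorsNonNull N 𝔩
    edgeVectorsNonNull no-sinks e null =
      contradicts (AcyclicDigraph.path-to-boundary digraph acyclic no-sinks e)
      where
      contradicts : ¬ (∃[ j ] ∃[ F ] IsPath e j F)
      contradicts (j , F , P) =
        sign-nonzero (σ e j) (∑-pos-nonempty (paths-complete acyclic P) w-pos)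
          (trans (sym (σ-factor e j)) (null j))

-- Le-graphs

module LeDiagrams {k n : ℕ} (k≤n : k ℕ.≤ n) (D : LeDiagram k n) where
  open LeDiagram D

  one? : ∀ r c → Dec (One r c)
  one? r c = filling r c Bool.≟ true

  fourValent? : ∀ r c → Dec (FourValent r c)
  fourValent? r c = Fin.any? (λ c′ → (c′ Fin.<? c) ×-dec one? r c′) ×-dec
                    Fin.any? (λ r′ → (r′ Fin.<? r) ×-dec one? r′ c)

  rowLabel<n : ∀ r → rowLabel r ℕ.< n
  rowLabel<n r = subst (rowLabel r ℕ.<_) (ℕ.m∸n+n≡m k≤n)
    (ℕ.+-mono-≤-< (ℕ.m∸n≤m (n ∸ k) (rowLength r)) (Fin.toℕ<n r))

  emitter : ∀ r c → One r c → ∃[ u ] Emits u r c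
  emitter r c o with fourValent? r c
  ... | yes f = white r c o f , white
  ... | no ¬f = unsplit r c o ¬f , unsplit

  -- Descent on the candidate `c′`: any `1` strictly between `c` and `c′` takes its place.
  nextRight : ∀ {r c} → One r c → ∀ c′ → Acc Fin._<_ c′ → c Fin.< c′ → One r c′ →
              ∃[ d ] NextLeft r d c
  nextRight {r} {c} o c′ (acc smaller) c<c′ o′
    with Fin.any? (λ d → (c Fin.<? d) ×-dec (d Fin.<? c′) ×-dec one? r d)
  ... | yes (d , c<d , d<c′ , od) = nextRight o d (smaller d<c′) c<d od
  ... | no none = c′ , o′ , o , c<c′ , λ d c<d d<c′ od → none (d , c<d , d<c′ , od)

  -- The line to the right of a `1` always reaches something, either the nearest `1` of the row or
  -- the border step of the row, so there is an incoming edge whatever the column contains.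
  edge-from-right : ∀ {r c v} → One r c → Receives v r c → ∃[ u ] LeEdge u v
  edge-from-right {r} {c} o receives with Fin.any? (λ c′ → (c Fin.<? c′) ×-dec one? r c′)
  ... | no none = _ , fromBorder (Fin.toℕ-fromℕ< (rowLabel<n r))
                                 (o , λ c′ c<c′ o′ → none (c′ , c<c′ , o′)) receives
  ... | yes (c′ , c<c′ , o′)
    with d , next@(od , _) ← nextRight o c′ (Fin.<-wellFounded c′) c<c′ o′
    with u , emits ← emitter r d od = u , leftwards next emits receives

  edge-into : ∀ v → (∀ j → v ≢ border j) → ∃[ u ] LeEdge u v
  edge-into (border j)        ≢border = contradiction refl (≢border j)
  edge-into (unsplit r c o f) _       = edge-from-right (recompute (one? r c) o) unsplit
  edge-into (black r c o f)   _       = edge-from-right (recompute (one? r c) o) black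
  edge-into (white r c o f)   _       = _ , split

  -- Edges run leftwards or downwards, so r + (n - c) grows from box to box. Doubling leaves an odd
  -- value free for the white vertex of a split box.
  boxRank : Fin k → Fin (n ∸ k) → ℕ
  boxRank r c = 2 ℕ.* (toℕ r ℕ.+ (n ∸ toℕ c))

  rank : LeVertex → ℕ
  -- An arbitrary value: ranks are compared only between vertices off the border.
  rank (border _)        = 0
  rank (unsplit r c _ _) = boxRank r c
  rank (black r c _ _)   = boxRank r c
  rank (white r c _ _)   = suc (boxRank r c)

  rank-emits : ∀ {u r c} → Emits u r c → rank u ℕ.≤ suc (boxRank r c)
  rank-emits unsplit = ℕ.n≤1+n _
  rank-emits white   = ℕ.≤-refl

  rank-receives : ∀ {v r c} → Receives v r c → rank v ≡ boxRank r c
  rank-receives unsplit = refl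
  rank-receives black   = refl

  rank-box : ∀ {u v r c r′ c′} → toℕ r ℕ.+ (n ∸ toℕ c) ℕ.< toℕ r′ ℕ.+ (n ∸ toℕ c′) →
             Emits u r c → Receives v r′ c′ → rank u ℕ.< rank v
  rank-box {r = r} {c} {r′} {c′} x<y emits receives rewrite rank-receives receives =
    ℕ.≤-<-trans (rank-emits emits)
      (subst (ℕ._≤ boxRank r′ c′) (ℕ.*-suc 2 (toℕ r ℕ.+ (n ∸ toℕ c))) (ℕ.*-monoʳ-≤ 2 x<y))

  rank-increases : ∀ {u v} → LeEdge u v → (∀ j → u ≢ border j) → (∀ j → v ≢ border j) → rank u ℕ.< rank v
  rank-increases (fromBorder _ _ _) u≢ _ = contradiction refl (u≢ _)
  rank-increases (toBorder _ _ _) _ v≢   = contradiction refl (v≢ _)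
  rank-increases split _ _               = ℕ.≤-refl
  rank-increases (leftwards {r} {c} (_ , _ , c′<c , _) emits receives) _ _ = rank-box
    (ℕ.+-monoʳ-< (toℕ r) (ℕ.∸-monoʳ-< c′<c (ℕ.≤-trans (ℕ.<⇒≤ (Fin.toℕ<n c)) (ℕ.m∸n≤m n k)))) emits receives
  rank-increases (downwards {c = c} (_ , _ , r<r′ , _) emits receives) _ _ =
    rank-box (ℕ.+-monoˡ-< (n ∸ toℕ c) r<r′) emits receives

module LeGraphs {k n : ℕ} (k≤n : k ℕ.≤ n) (G : Digraph n) (le : IsLeGraph k G) where
  open Digraph G
  open IsLeGraph le
  open LeDiagram diagram
  open LeDiagrams k≤n diagram

  to : Vertex → LeVertex
  to = Inverse.to vertices

  to-injective : ∀ {u v} → to u ≡ to v → u ≡ v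
  to-injective p = trans (sym (Inverse.strictlyInverseʳ vertices _))
    (trans (cong (Inverse.from vertices) p) (Inverse.strictlyInverseʳ vertices _))

  at-border : ∀ {v} j → to v ≡ border j → v ≡ boundary j
  at-border j p = to-injective (trans p (sym (keeps-labels j)))

  noInternalSources : NoInternalSources
  noInternalSources v =
    length≢0 (∈-filter⁺ (λ e → target e ≟ᵥ internal v) (∈-allFin (proj₁ edge)) (proj₂ (proj₂ edge)))
    where
    le-edge = edge-into (to (internal v)) (λ j p → contradiction (at-border j p) λ ())
    u = proj₁ le-edge
    edge : Inverse.from vertices u ⟶ internal v
    edge = Equivalence.from (keeps-edges _ _)
      (subst (λ u → LeEdge u (to (internal v))) (sym (Inverse.strictlyInverseˡ vertices u)) (proj₂ le-edge))

  module _ (no-through-boundary : ∀ {e f j} → target e ≡ boundary j → source f ≢ boundary j) where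
    private
      first : ∀ {u v} → TransClosure _⟶_ u v → ∃[ f ] source f ≡ u
      first [ f , p , _ ]      = f , p
      first ((f , p , _) ∷ _)  = f , p

      last : ∀ {u v} → TransClosure _⟶_ u v → ∃[ e ] target e ≡ v
      last [ e , _ , p ] = e , p
      last (_ ∷ P)       = last P

      ≢border : ∀ {v} → ∃[ e ] target e ≡ v → ∃[ f ] source f ≡ v → ∀ j → to v ≢ border j
      ≢border (e , p) (f , q) j r =
        no-through-boundary (trans p (at-border j r)) (trans q (at-border j r))

      -- A vertex that is both entered and left is not on the border, by the degrees of the boundary
      -- vertices. The two extra edges secure this at the ends of the walk; for a cycle they are
      -- taken from the cycle itself.
      ascent : ∀ {u v} → ∃[ e ] target e ≡ u → TransClosure _⟶_ u v → ∃[ f ] source f ≡ v →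
               rank (to u) ℕ.< rank (to v)
      ascent into [ s@(e , p , q) ] out = rank-increases (Equivalence.to (keeps-edges _ _) s)
        (≢border into (e , p)) (≢border (e , q) out)
      ascent into (s@(e , p , q) ∷ P) out = ℕ.<-trans
        (rank-increases (Equivalence.to (keeps-edges _ _) s) (≢border into (e , p)) (≢border (e , q) (first P)))
        (ascent (e , q) P out)

    acyclic : Acyclic
    acyclic v P = ℕ.<-irrefl refl (ascent (last P) P (first P))

open import Data.Nat using (_<_)

theorem7p1 : (ℝ : RealNumbers) → let open Plabic ℝ in
    (k n : ℕ) → 0 < k → k < n →
    (N : PlabicNetwork k n) (𝔩 : GaugeRayDirection (PlabicNetwork.graph N)) →
    PlabicNetwork.RepresentsIrreduciblePoint N →
    (PlabicNetwork.Acyclic N → PlabicNetwork.NoInternalSources N → PlabicNetwork.NoInternalSinks N →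
    EdgeVectorsNonNull N 𝔩 × EdgeVectorFormula N 𝔩)
    × (IsLeNetwork N → EdgeVectorFormula N 𝔩)
theorem7p1 ℝ k n _ k<n N 𝔩 _ =
  (λ acyclic no-sources no-sinks →
    edgeVectorsNonNull acyclic no-sources no-sinks , edgeVectorFormula acyclic no-sources) ,
  λ le → let open LeGraphs (ℕ.<⇒≤ k<n) digraph le in
    edgeVectorFormula (acyclic no-through-boundary) noInternalSources
  where
  open Plabic ℝ
  open PlabicNetwork N using (digraph)
  open Drawing ℝ N 𝔩 using (no-through-boundary)
  open EdgeVectors ℝ N 𝔩
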